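{- Let $G$ be a bridgeless cubic graph with oddness $\omega=\omega(G)$. If $m_G^* \geq \frac{5}{2}\omega - 1$, then $G$ has a nowhere-zero $5$-flow.
   Context: Graphs may have multiple edges but no loops. An orientation $D$ of a graph $M=(V,E)$ assigns a direction to each edge; for $v\in V$, $D^+(v)$ ($D^-(v)$) is the set of edges whose tail (head) is $v$. For an integer $k\ge 2$, a $k$-flow on $M$ is a pair $(D,\varphi)$ with $\varphi:E\to\{0,1,\dots,k-1\}$ such that $\sum_{e\in D^+(v)}\varphi(e)=\sum_{e\in D^-(v)}\varphi(e)$ for every $v\in V$; it is nowhere-zero if $\varphi(e)\neq 0$ for all $e$. The oddness $\omega(G)$ of a bridgeless cubic graph $G$ is the minimum number of odd cycles in a 2-factor of $G$; a minimum 2-factor is a 2-factor with exactly $\omega(G)$ odd cycles. For a minimum 2-factor $\mathcal{F}_2$ of $G=(V,E)$: if $\omega(G)\ge 2$, $m_G(\mathcal{F}_2)$ is the maximum number $k$ such that there is no edge cut $E'\subset E$ with fewer than $k$ edges such that two components of $G-E'$ contain odd cycles of $\mathcal{F}_2$; if $\omega(G)=0$, $m_G(\mathcal{F}_2)=\infty$. Finally $m_G^*=\max\{m_G(\mathcal{F}_2) : \mathcal{F}_2 \text{ a minimum 2-factor of } G\}$. -}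

module Defs where

open import Data.Nat using (ℕ; zero; suc; _+_; _*_; _≤_; _%_)
open import Data.Bool using (Bool; true; false; _∨_; if_then_else_)
open import Data.Fin using (Fin; _≟_)
import Data.Fin
open import Data.Fin.Subset using (Subset; _∈_; _∉_; _∩_; ∁; ⁅_⁆; ⊤; ∣_∣)
open import Data.Vec using (tabulate)
import Data.List as L
open import Data.Nat.ListAction using (sum)
open import Data.Product using (Σ; ∃; ∃-syntax; _×_; _,_; proj₁; proj₂)
open import Relation.Nullary using (¬_; Dec; yes; no)
open import Relation.Nullary.Decidable using (⌊_⌋)
open import Relation.Binary.PropositionalEquality using (_≡_; _≢_)
import Data.Nat as N

record Graph : Set where
  field
    n    : ℕ
    m    : ℕ
    end₁ : Fin m → Fin n
    end₂ : Fin m → Fin n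
    loopless : ∀ e → end₁ e ≢ end₂ e
open Graph public

module _ (G : Graph) where

  incident : Fin (n G) → Subset (m G)
  incident v = tabulate (λ e → ⌊ end₁ G e ≟ v ⌋ ∨ ⌊ end₂ G e ≟ v ⌋)

  degIn : Subset (m G) → Fin (n G) → ℕ
  degIn S v = ∣ incident v ∩ S ∣

  Cubic : Set
  Cubic = ∀ v → degIn ⊤ v ≡ 3

  data Path (S : Subset (m G)) : Fin (n G) → Fin (n G) → Set where
    here  : ∀ {x} → Path S x x
    step₁ : ∀ {y} e → e ∈ S → Path S (end₂ G e) y → Path S (end₁ G e) y
    step₂ : ∀ {y} e → e ∈ S → Path S (end₁ G e) y → Path S (end₂ G e) y

  Bridgeless : Set
  Bridgeless = ∀ e → Path (∁ ⁅ e ⁆) (end₁ G e) (end₂ G e)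

  TwoFactor : Subset (m G) → Set
  TwoFactor F = ∀ v → degIn F v ≡ 2

  -- c : V → Fin k labels exactly the connected components of (V , F)
  -- (the cycles of the 2-factor F), the k labels all being used
  IsComponentLabelling : Subset (m G) → (k : ℕ) → (Fin (n G) → Fin k) → Set
  IsComponentLabelling F k c =
    (∀ e → e ∈ F → c (end₁ G e) ≡ c (end₂ G e)) ×
    (∀ x y → c x ≡ c y → Path F x y) ×
    (∀ j → ∃[ x ] c x ≡ j)

  classSize : ∀ {k} → (Fin (n G) → Fin k) → Fin k → ℕ
  classSize c j = ∣ tabulate (λ x → ⌊ c x ≟ j ⌋) ∣

  IsOdd : ℕ → Set
  IsOdd a = a % 2 ≡ 1

  oddClasses : ∀ {k} → (Fin (n G) → Fin k) → ℕ
  oddClasses c = ∣ tabulate (λ j → ⌊ classSize c j % 2 N.≟ 1 ⌋) ∣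

  NumOddCycles : Subset (m G) → ℕ → Set
  NumOddCycles F t =
    Σ ℕ λ k → Σ (Fin (n G) → Fin k) λ c → IsComponentLabelling F k c × oddClasses c ≡ t

  IsOddness : ℕ → Set
  IsOddness w =
    (Σ (Subset (m G)) λ F → TwoFactor F × NumOddCycles F w) ×
    (∀ F t → TwoFactor F → NumOddCycles F t → w ≤ t)

  -- minimum 2-factor (given ω(G) = w)
  MinimumTwoFactor : ℕ → Subset (m G) → Set
  MinimumTwoFactor w F = TwoFactor F × NumOddCycles F w

  SeparatesOddCycles : Subset (m G) → ∀ {k} → (Fin (n G) → Fin k) → Subset (m G) → Set
  SeparatesOddCycles F {k} c E' =
    Σ (Fin k) λ i → Σ (Fin k) λ j →
      i ≢ j × IsOdd (classSize c i) × IsOdd (classSize c j) ×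
      (∀ e → e ∈ F → c (end₁ G e) ≡ i → e ∉ E') ×
      (∀ e → e ∈ F → c (end₁ G e) ≡ j → e ∉ E') ×
      Σ (Fin (n G)) λ x → Σ (Fin (n G)) λ y →
        c x ≡ i × c y ≡ j × ¬ Path (∁ E') x y

  -- m_G(F) ≥ 5w/2 - 1 : every edge cut separating two odd cycles of F
  -- has at least 5w/2 - 1 edges, i.e. 5w ≤ 2|E'| + 2.
  -- (If F has no odd cycles this holds vacuously, matching m_G(F) = ∞.)
  mBound : ℕ → Subset (m G) → Set
  mBound w F =
    ∀ k (c : Fin (n G) → Fin k) → IsComponentLabelling F k c →
    ∀ E' → SeparatesOddCycles F c E' → 5 * w ≤ 2 * ∣ E' ∣ + 2

  -- m*_G ≥ 5ω/2 - 1 (with ω(G) = w): some minimum 2-factor F has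
  -- m_G(F) ≥ 5w/2 - 1.
  MStarBound : ℕ → Set
  MStarBound w = Σ (Subset (m G)) λ F → MinimumTwoFactor w F × mBound w F

  sumE : (Fin (m G) → ℕ) → ℕ
  sumE f = sum (L.tabulate f)

  tail : (Fin (m G) → Bool) → Fin (m G) → Fin (n G)
  tail D e = if D e then end₁ G e else end₂ G e

  head : (Fin (m G) → Bool) → Fin (m G) → Fin (n G)
  head D e = if D e then end₂ G e else end₁ G e

  NowhereZeroFlow : ℕ → Set
  NowhereZeroFlow k =
    Σ (Fin (m G) → Bool) λ D → Σ (Fin (m G) → Fin k) λ φ →
      (∀ e → Data.Fin.toℕ (φ e) ≢ 0) ×
      (∀ v → sumE (λ e → if ⌊ tail D e ≟ v ⌋ then Data.Fin.toℕ (φ e) else 0)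
           ≡ sumE (λ e → if ⌊ head D e ≟ v ⌋ then Data.Fin.toℕ (φ e) else 0))

{-# OPTIONS --safe #-}

-- Let F be the given 2-factor with ω odd cycles and M its complement. Alternating along the cycles of F gives
-- N ⊆ F such that J = M ∪ N has even degree except at one root vertex on each odd cycle. Orient F as a
-- circulation g and J as h with excess 0, or ±1 at the roots. Then 2g + h has absolute value 1, 2 or 3 on every
-- edge; let D be the orientation by its signs. By Hoffman's theorem D carries a circulation with values in
-- 1, …, 4 as soon as d⁺(X) ≤ 4 d⁻(X) for every vertex set X. Let κ be the excess of 2g + h on X, so that
-- d⁺ ≤ 3 d⁻ + κ and 2κ ≤ ω. If d⁻ < κ, then 2(d⁺ + d⁻) + 2 ≤ 10κ − 6 < 5ω, so ∂X does not separate two odd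
-- cycles; hence every odd cycle meeting X leaves X, or every odd cycle meeting the complement enters X.
-- As g is a circulation directed along D, each cycle crossing ∂X enters X at least once, whence κ ≤ d⁻ after all.
module Submission where

open import Defs
open import Data.Nat using (ℕ)

open import Data.Bool using (Bool; true; false; not; _∧_; _∨_; _xor_; if_then_else_)
import Data.Bool as B
open import Data.Bool.Properties using (xor-same; ¬-not)
open import Data.Empty using (⊥-elim)
open import Data.Fin using (Fin; zero; suc; _≟_)
import Data.Fin as Fin
open import Data.Fin.Properties using (any?; all?; ¬∀⟶∃¬; toℕ-fromℕ<)
open import Data.Fin.Subset using (Subset; _∈_; _∉_; _∩_; ∁; ⊤) renaming (∣_∣ to card)
open import Data.Fin.Subset.Properties using (x∈∁p⇒x∉p)
open import Data.Integer using (ℤ; +_; -[1+_]; 0ℤ; 1ℤ; _+_; _-_; _*_; -_; _≤_; _<_; _⊔_; _⊓_; +≤+; -≤+; -≤-; +<+; _<?_; _≤?_; ∣_∣; nonNegative)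
open import Data.Integer.DivMod using (_%ℕ_; _/ℕ_; n%ℕd<d; a≡a%ℕn+[a/ℕn]*n)
open import Data.Integer.Divisibility.Signed using (_∣_; divides; ∣m∣n⇒∣m+n; ∣m∣n⇒∣m-n; ∣⇒∣ᵤ; ∣m⇒∣-m; ∣n⇒∣m*n)
open import Data.Integer.Properties hiding (_≟_)
open import Data.Integer.Tactic.RingSolver using (solve-∀)
import Data.List as L
open import Data.Nat using (zero; suc; z≤n; s≤s)
import Data.Nat as N
import Data.Nat.Divisibility as ND
import Data.Nat.ListAction as LA
open import Data.Product using (∃; ∃-syntax; _×_; _,_; proj₁; proj₂)
open import Data.Sum using (_⊎_; inj₁; inj₂)
open import Data.Vec using ([]; _∷_; lookup; tabulate)
open import Data.Vec.Properties using (lookup∘tabulate; lookup-zipWith; lookup-replicate; []=⇒lookup; lookup⇒[]=)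
open import Function using (_∘_)
open import Relation.Binary.PropositionalEquality
open import Relation.Nullary using (¬_; Dec; yes; no; contradiction)
open import Relation.Nullary.Decidable using (⌊_⌋; _×-dec_; _⊎-dec_; _→-dec_)
import Algebra.Properties.Semiring.Sum +-*-semiring as Sum

-- Finite sums of integers

-- Opacity makes ∑ injective for unification.
opaque
  sum : ∀ {n} → (Fin n → ℤ) → ℤ
  sum = Sum.sum

sum-syntax : ∀ n → (Fin n → ℤ) → ℤ
sum-syntax n = sum

infixl 10 sum-syntax
syntax sum-syntax n (λ i → x) = ∑[ i < n ] x

opaque
  unfolding sum

  sum-suc : ∀ {n} (f : Fin (suc n) → ℤ) → sum f ≡ f zero + sum (f ∘ suc)
  sum-suc f = refl

  sum-cong : ∀ {n} {f g : Fin n → ℤ} → (∀ i → f i ≡ g i) → sum f ≡ sum g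
  sum-cong = Sum.sum-cong-≗

  ∑-distrib-+ : ∀ {n} (f g : Fin n → ℤ) → ∑[ i < n ] (f i + g i) ≡ sum f + sum g
  ∑-distrib-+ = Sum.∑-distrib-+

  ∑-comm : ∀ {m n} (f : Fin m → Fin n → ℤ) → ∑[ i < m ] ∑[ j < n ] f i j ≡ ∑[ j < n ] ∑[ i < m ] f i j
  ∑-comm = Sum.∑-comm

  *-distribˡ-sum : ∀ {n} x (f : Fin n → ℤ) → x * sum f ≡ ∑[ i < n ] (x * f i)
  *-distribˡ-sum = Sum.*-distribˡ-sum

  sum-empty : ∀ (f : Fin 0 → ℤ) → sum f ≡ 0ℤ
  sum-empty f = refl

  sum-0 : ∀ {n} {f : Fin n → ℤ} → (∀ i → f i ≡ 0ℤ) → sum f ≡ 0ℤ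
  sum-0 {n} f≡0 = trans (sum-cong f≡0) (Sum.sum-replicate-zero n)

  sum-1 : ∀ n → ∑[ x < n ] 1ℤ ≡ + n
  sum-1 zero    = refl
  sum-1 (suc n) = cong (_+_ 1ℤ) (sum-1 n)

  sum-mono : ∀ {n} {f g : Fin n → ℤ} → (∀ i → f i ≤ g i) → sum f ≤ sum g
  sum-mono {zero}  f≤g = ≤-refl
  sum-mono {suc n} f≤g = +-mono-≤ (f≤g zero) (sum-mono (f≤g ∘ suc))

  sum-mono-< : ∀ {n} {f g : Fin n → ℤ} → (∀ i → f i ≤ g i) → ∀ i → f i < g i → sum f < sum g
  sum-mono-< f≤g zero    lt = +-mono-<-≤ lt (sum-mono (f≤g ∘ suc))
  sum-mono-< f≤g (suc i) lt = +-mono-≤-< (f≤g zero) (sum-mono-< (f≤g ∘ suc) i lt)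

  sum-neg : ∀ {n} (f : Fin n → ℤ) → ∑[ i < n ] (- f i) ≡ - sum f
  sum-neg {zero}  f = refl
  sum-neg {suc n} f = trans (cong (_+_ (- f zero)) (sum-neg (f ∘ suc))) (sym (neg-distrib-+ (f zero) _))

sum-diff : ∀ {n} (f g : Fin n → ℤ) → ∑[ i < n ] (f i - g i) ≡ sum f - sum g
sum-diff f g = trans (∑-distrib-+ f (λ i → - g i)) (cong (_+_ (sum f)) (sum-neg g))

sum-nonneg : ∀ {n} {f : Fin n → ℤ} → (∀ i → 0ℤ ≤ f i) → 0ℤ ≤ sum f
sum-nonneg f≥0 = ≤-trans (≤-reflexive (sym (sum-0 (λ _ → refl)))) (sum-mono f≥0)

-- Indicators, crossing edges and growing vertex sets

⟦_⟧ : Bool → ℤ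
⟦ true ⟧  = 1ℤ
⟦ false ⟧ = 0ℤ

⟦⟧≥0 : ∀ x → 0ℤ ≤ ⟦ x ⟧
⟦⟧≥0 true  = +≤+ z≤n
⟦⟧≥0 false = ≤-refl

i≤∣i∣ : ∀ i → i ≤ + ∣ i ∣
i≤∣i∣ (+ n)    = ≤-refl
i≤∣i∣ -[1+ n ] = -≤+

δ : ∀ {n} → Fin n → Fin n → ℤ
δ x y = ⟦ ⌊ x ≟ y ⌋ ⟧

δ-refl : ∀ {n} (x : Fin n) → δ x x ≡ 1ℤ
δ-refl x with x ≟ x
... | yes _ = refl
... | no ¬p = contradiction refl ¬p

δ-≢ : ∀ {n} {x y : Fin n} → x ≢ y → δ x y ≡ 0ℤ
δ-≢ {x = x} {y} x≢y with x ≟ y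
... | yes p = contradiction p x≢y
... | no _  = refl

δ-suc : ∀ {n} (x y : Fin n) → δ (suc x) (suc y) ≡ δ x y
δ-suc x y with x ≟ y
... | yes refl = refl
... | no  _    = refl

sum-δ : ∀ {n} (x : Fin n) (h : Fin n → ℤ) → ∑[ v < n ] (δ x v * h v) ≡ h x
sum-δ {suc n} zero h = trans (sum-suc _)
  (trans (cong₂ _+_ (*-identityˡ (h zero)) (sum-0 {n} (λ _ → refl))) (+-identityʳ (h zero)))
sum-δ {suc n} (suc x) h = trans (sum-suc _) (trans (+-identityˡ _)
  (trans (sum-cong (λ v → cong (_* h (suc v)) (δ-suc x v))) (sum-δ x (h ∘ suc))))

cross : Bool → Bool → ℤ
cross x y = ⟦ x ∧ not y ⟧

cross-diff : ∀ x y → ⟦ x ⟧ - ⟦ y ⟧ ≡ cross x y - cross y x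
cross-diff true  true  = refl
cross-diff true  false = refl
cross-diff false true  = refl
cross-diff false false = refl

insert : ∀ {n} → (Fin n → Bool) → Fin n → Fin n → Bool
insert R y x = R x ∨ ⌊ y ≟ x ⌋

insert-old : ∀ {n} (R : Fin n → Bool) y {x} → R x ≡ true → insert R y x ≡ true
insert-old R y Rx rewrite Rx = refl

insert-new : ∀ {n} (R : Fin n → Bool) y → insert R y y ≡ true
insert-new R y with R y | y ≟ y
... | true  | _      = refl
... | false | yes _  = refl
... | false | no y≢y = contradiction refl y≢y

insert-sound : ∀ {n} (R : Fin n → Bool) y {x} → insert R y x ≡ true → R x ≡ true ⊎ y ≡ x
insert-sound R y {x} p with R x | y ≟ x
... | true  | _       = inj₁ refl
... | false | yes y≡x = inj₂ y≡x
insert-sound R y {x} () | false | no _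

⟦⟧-mono : ∀ {x y} → (x ≡ true → y ≡ true) → ⟦ x ⟧ ≤ ⟦ y ⟧
⟦⟧-mono {false} {false} _ = ≤-refl
⟦⟧-mono {false} {true}  _ = +≤+ z≤n
⟦⟧-mono {true}  {y}     h rewrite h refl = ≤-refl

card-insert : ∀ {n} (R : Fin n → Bool) y → R y ≡ false →
  ∑[ x < n ] ⟦ R x ⟧ < ∑[ x < n ] ⟦ insert R y x ⟧
card-insert R y ¬Ry = sum-mono-< (λ x → ⟦⟧-mono (insert-old R y)) y
  (subst₂ (λ p q → ⟦ p ⟧ < ⟦ q ⟧) (sym ¬Ry) (sym (insert-new R y)) (+<+ (s≤s z≤n)))

-- Excess of functions on the edges

module _ {n m : ℕ} (s t : Fin m → Fin n) where

  -- Net outflow: lowering `f` on an edge lowers the excess at its tail and raises it at its head.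
  exc : (Fin m → ℤ) → Fin n → ℤ
  exc f v = ∑[ e < m ] ((δ (s e) v - δ (t e) v) * f e)

  -- Summation by parts. For `h` the indicator of a vertex set, the right side is the net flow out
  -- of the set, since only edges crossing its boundary contribute.
  sum-exc : ∀ (h : Fin n → ℤ) f → ∑[ v < n ] (h v * exc f v) ≡ ∑[ e < m ] ((h (s e) - h (t e)) * f e)
  sum-exc h f = begin
    ∑[ v < n ] (h v * exc f v)
      ≡⟨ sum-cong (λ v → *-distribˡ-sum (h v) _) ⟩
    ∑[ v < n ] ∑[ e < m ] (h v * ((δ (s e) v - δ (t e) v) * f e))
      ≡⟨ ∑-comm _ ⟩
    ∑[ e < m ] ∑[ v < n ] (h v * ((δ (s e) v - δ (t e) v) * f e))
      ≡⟨ sum-cong column ⟩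
    ∑[ e < m ] ((h (s e) - h (t e)) * f e) ∎
    where
    open ≡-Reasoning
    expand : ∀ h a b c → h * ((a - b) * c) ≡ a * (h * c) - b * (h * c)
    expand = solve-∀
    factor : ∀ a b c → a * c - b * c ≡ (a - b) * c
    factor = solve-∀
    column : ∀ e → ∑[ v < n ] (h v * ((δ (s e) v - δ (t e) v) * f e)) ≡ (h (s e) - h (t e)) * f e
    column e = begin
      ∑[ v < n ] (h v * ((δ (s e) v - δ (t e) v) * f e))
        ≡⟨ sum-cong (λ v → expand (h v) (δ (s e) v) (δ (t e) v) (f e)) ⟩
      ∑[ v < n ] (δ (s e) v * (h v * f e) - δ (t e) v * (h v * f e))
        ≡⟨ sum-diff _ _ ⟩
      ∑[ v < n ] (δ (s e) v * (h v * f e)) - ∑[ v < n ] (δ (t e) v * (h v * f e))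
        ≡⟨ cong₂ _-_ (sum-δ (s e) _) (sum-δ (t e) _) ⟩
      h (s e) * f e - h (t e) * f e
        ≡⟨ factor (h (s e)) (h (t e)) (f e) ⟩
      (h (s e) - h (t e)) * f e ∎

  exc-+ : ∀ f g v → exc (λ e → f e + g e) v ≡ exc f v + exc g v
  exc-+ f g v = trans (sum-cong (λ e → *-distribˡ-+ (δ (s e) v - δ (t e) v) (f e) (g e))) (∑-distrib-+ _ _)

  exc-unit : ∀ a k v → exc (λ e → δ a e * k) v ≡ (δ (s a) v - δ (t a) v) * k
  exc-unit a k v = trans (sum-cong (λ e → swap (δ (s e) v - δ (t e) v) (δ a e) k)) (sum-δ a _)
    where
    swap : ∀ x d k → x * (d * k) ≡ d * (x * k)
    swap = solve-∀

exc-reverse : ∀ {n m} (s t : Fin m → Fin n) f v → exc t s f v ≡ - exc s t f v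
exc-reverse s t f v = trans (sum-cong (λ e → flip (δ (s e) v) (δ (t e) v) (f e))) (sum-neg _)
  where
  flip : ∀ a b c → (b - a) * c ≡ - ((a - b) * c)
  flip = solve-∀

-- The hypotheses are what the absence of residual edges gives: `f` is down to `l` on an edge
-- leaving the set and up to `u` on one entering it, so the edge contributes no more outflow than
-- its bounds force.
cross-≤ : ∀ x y {f l u} → (x ≡ true → y ≡ false → f ≤ l) → (y ≡ true → x ≡ false → u ≤ f) →
  (⟦ x ⟧ - ⟦ y ⟧) * f ≤ cross x y * l - cross y x * u
cross-≤ true  true  _ _ = ≤-refl
cross-≤ false false _ _ = ≤-refl
cross-≤ true  false {f} {l} {u} p _ = subst₂ _≤_ (lhs f) (rhs l u) (p refl refl)
  where
  lhs : ∀ f → f ≡ (1ℤ - 0ℤ) * f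
  lhs = solve-∀
  rhs : ∀ l u → l ≡ 1ℤ * l - 0ℤ * u
  rhs = solve-∀
cross-≤ false true {f} {l} {u} _ p = subst₂ _≤_ (lhs f) (rhs l u) (neg-mono-≤ (p refl refl))
  where
  lhs : ∀ f → - f ≡ (0ℤ - 1ℤ) * f
  lhs = solve-∀
  rhs : ∀ l u → - u ≡ 0ℤ * l - 1ℤ * u
  rhs = solve-∀

⟦⟧*-mono : ∀ x {a b} → (x ≡ true → a ≤ b) → ⟦ x ⟧ * a ≤ ⟦ x ⟧ * b
⟦⟧*-mono true  {a} {b} h = subst₂ _≤_ (sym (*-identityˡ a)) (sym (*-identityˡ b)) (h refl)
⟦⟧*-mono false h = ≤-refl

-- Augmentation of bounded flows

module Flow {n m : ℕ} (s t : Fin m → Fin n) (l u : Fin m → ℤ) where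

  Feasible : (Fin m → ℤ) → Set
  Feasible f = ∀ e → l e ≤ f e × f e ≤ u e

  -- From any feasible flow agreeing with f inside R, one unit of excess can be moved from v to w.
  -- Quantifying over such flows is what lets R grow without extracting simple paths.
  Moves : (Fin m → ℤ) → Fin n → (Fin n → Bool) → Set
  Moves f v R = ∀ w → R w ≡ true → ∀ g → Feasible g →
    (∀ e → R (s e) ≡ true → R (t e) ≡ true → g e ≡ f e) →
    ∃[ h ] Feasible h × (∀ x → exc s t h x ≡ exc s t g x - δ v x + δ w x)

  -- The edges over which a unit of excess can leave `R`. As excess is net outflow, this means
  -- lowering the flow on an edge out of `R` or raising it on an edge into `R`.
  Residual : (Fin m → ℤ) → (Fin n → Bool) → Fin m → Set
  Residual f R e = (R (s e) ≡ true × R (t e) ≡ false × l e < f e)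
                 ⊎ (R (t e) ≡ true × R (s e) ≡ false × f e < u e)

  residual? : ∀ f R e → Dec (Residual f R e)
  residual? f R e =
    ((R (s e) B.≟ true) ×-dec ((R (t e) B.≟ false) ×-dec (l e <? f e)))
    ⊎-dec ((R (t e) B.≟ true) ×-dec ((R (s e) B.≟ false) ×-dec (f e <? u e)))

  -- The new edge is used first: adding `d` on `e` takes a unit of excess from `x` to `y`, after
  -- which `moves` brings a unit from `v` to `x`. The bounds hold on `e` because `g` equals `f`
  -- there, and agreement inside `R` survives because `e` does not lie inside `R`.
  extend : ∀ f v R x y e d → Moves f v R → R x ≡ true →
    insert R y (s e) ≡ true → insert R y (t e) ≡ true →
    ¬ (R (s e) ≡ true × R (t e) ≡ true) →
    (∀ z → (δ (s e) z - δ (t e) z) * d ≡ δ y z - δ x z) →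
    l e ≤ f e + d × f e + d ≤ u e →
    Moves f v (insert R y)
  extend f v R x y e d moves Rx ins int ¬inside exc-d bnd w R′w g g-feas agree
    with insert-sound R y R′w
  ... | inj₁ Rw = moves w Rw g g-feas (λ e′ p q → agree e′ (insert-old R y p) (insert-old R y q))
  ... | inj₂ refl with moves x Rx g′ feas′ agree′
    where
    g′ : Fin m → ℤ
    g′ e′ = g e′ + δ e e′ * d
    same : ∀ {e′} → e ≢ e′ → g′ e′ ≡ g e′
    same {e′} e≢e′ = trans (cong (λ i → g e′ + i * d) (δ-≢ e≢e′)) (+-identityʳ (g e′))
    feas′ : Feasible g′
    feas′ e′ with e ≟ e′
    ... | yes refl = subst (λ i → l e ≤ i × i ≤ u e)
                       (sym (cong₂ _+_ (agree e ins int) (*-identityˡ d))) bnd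
    ... | no e≢e′  = subst (λ i → l e′ ≤ i × i ≤ u e′) (sym (+-identityʳ (g e′))) (g-feas e′)
    agree′ : ∀ e′ → R (s e′) ≡ true → R (t e′) ≡ true → g′ e′ ≡ f e′
    agree′ e′ p q = trans (same (λ { refl → ¬inside (p , q) }))
                      (agree e′ (insert-old R y p) (insert-old R y q))
  ... | h , h-feas , h-exc = h , h-feas , λ z →
    trans (h-exc z) (trans (cong (λ i → i - δ v z + δ x z)
      (trans (exc-+ s t g (λ e′ → δ e e′ * d) z) (cong (λ i → exc s t g z + i) (trans (exc-unit s t e d z) (exc-d z)))))
      (rearrange (exc s t g z) (δ y z) (δ x z) (δ v z)))
    where
    rearrange : ∀ g y x v → (g + (y - x)) - v + x ≡ g - v + y
    rearrange = solve-∀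

  grow : ∀ f v R e → Feasible f → Moves f v R → Residual f R e →
    ∃[ y ] R y ≡ false × Moves f v (insert R y)
  grow f v R e feas moves (inj₁ (Rs , ¬Rt , lt)) = t e , ¬Rt ,
    extend f v R (s e) (t e) e (- 1ℤ) moves Rs (insert-old R (t e) Rs) (insert-new R (t e))
      (λ (_ , Rt) → contradiction (trans (sym Rt) ¬Rt) λ ())
      (λ z → turn (δ (s e) z) (δ (t e) z))
      (subst (l e ≤_) (+-comm (- 1ℤ) (f e)) (i<j⇒i≤pred[j] lt)
       , ≤-trans (i≤j⇒i-k≤j 1ℤ ≤-refl) (proj₂ (feas e)))
    where
    turn : ∀ a b → (a - b) * - 1ℤ ≡ b - a
    turn = solve-∀
  grow f v R e feas moves (inj₂ (Rt , ¬Rs , lt)) = s e , ¬Rs ,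
    extend f v R (t e) (s e) e 1ℤ moves Rt (insert-new R (s e)) (insert-old R (s e) Rt)
      (λ (Rs , _) → contradiction (trans (sym Rs) ¬Rs) λ ())
      (λ z → *-identityʳ (δ (s e) z - δ (t e) z))
      (≤-trans (proj₁ (feas e)) (i≤i+j (f e) 1ℤ)
       , subst (_≤ u e) (+-comm 1ℤ (f e)) (i<j⇒suc[i]≤j lt))

  -- Every growth step adds a vertex to `R`. With no fuel left `R` already has `n` vertices, so a
  -- further residual edge is absurd.
  closure : ∀ f v → Feasible f → ∀ fuel R → R v ≡ true → Moves f v R →
    + n ≤ ∑[ x < n ] ⟦ R x ⟧ + + fuel →
    ∃[ R′ ] R′ v ≡ true × Moves f v R′ × (∀ e → ¬ Residual f R′ e)
  closure f v feas fuel R Rv moves bound with any? (residual? f R)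
  ... | no none = R , Rv , moves , λ e r → none (e , r)
  ... | yes (e , r) with grow f v R e feas moves r
  closure f v feas zero R Rv moves bound | yes _ | y , ¬Ry , _ =
    ⊥-elim (<-irrefl refl (begin-strict
      + n                            ≤⟨ bound ⟩
      ∑[ x < n ] ⟦ R x ⟧ + 0ℤ        ≡⟨ +-identityʳ _ ⟩
      ∑[ x < n ] ⟦ R x ⟧             <⟨ card-insert R y ¬Ry ⟩
      ∑[ x < n ] ⟦ insert R y x ⟧    ≤⟨ sum-mono (λ x → ⟦⟧-mono {insert R y x} {true} (λ _ → refl)) ⟩
      ∑[ x < n ] 1ℤ                  ≡⟨ sum-1 n ⟩
      + n ∎))
    where open ≤-Reasoning
  closure f v feas (suc fuel) R Rv moves bound | yes _ | y , ¬Ry , moves′ =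
    closure f v feas fuel (insert R y) (insert-old R y Rv) moves′ (begin
      + n                                       ≤⟨ bound ⟩
      ∑[ x < n ] ⟦ R x ⟧ + (1ℤ + + fuel)        ≡⟨ shift (∑[ x < n ] ⟦ R x ⟧) (+ fuel) ⟩
      (1ℤ + ∑[ x < n ] ⟦ R x ⟧) + + fuel        ≤⟨ +-monoˡ-≤ (+ fuel) (i<j⇒suc[i]≤j (card-insert R y ¬Ry)) ⟩
      ∑[ x < n ] ⟦ insert R y x ⟧ + + fuel ∎)
    where
    open ≤-Reasoning
    shift : ∀ a b → a + (1ℤ + b) ≡ (1ℤ + a) + b
    shift = solve-∀

  module _ (b : Fin n → ℤ)
    (cut : ∀ (R : Fin n → Bool) → ∑[ e < m ] (cross (R (s e)) (R (t e)) * l e - cross (R (t e)) (R (s e)) * u e)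
               ≤ ∑[ v < n ] (⟦ R v ⟧ * b v)) where

    -- Let `R` be closed under residual edges from `v`. If no vertex of `R` were below its bound,
    -- the excess of `R` would exceed the sum of `b` over `R`. But without residual edges the net
    -- outflow from `R` is at most what the edge bounds force, and `cut` keeps this within that sum.
    improve : ∀ f v → Feasible f → b v < exc s t f v →
      ∃[ w ] exc s t f w < b w ×
        (∃[ h ] Feasible h × (∀ x → exc s t h x ≡ exc s t f x - δ v x + δ w x))
    improve f v feas over with closure f v feas n (λ x → ⌊ v ≟ x ⌋) v∈ start (i≤j+i (+ n) _ {{nn}})
      where
      nn = nonNegative (sum-nonneg (λ x → ⟦⟧≥0 ⌊ v ≟ x ⌋))
      v∈ : ⌊ v ≟ v ⌋ ≡ true
      v∈ with v ≟ v
      ... | yes _ = refl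
      ... | no ¬p = contradiction refl ¬p
      cancel : ∀ a b → a ≡ a - b + b
      cancel = solve-∀
      start : Moves f v (λ x → ⌊ v ≟ x ⌋)
      start w vw g feas _ with v ≟ w
      start w vw g feas _ | yes refl = g , feas , λ x → cancel (exc s t g x) (δ v x)
      start w () g feas _ | no _
    ... | R , Rv , moves , closed with any? (λ w → (R w B.≟ true) ×-dec (exc s t f w <? b w))
    ... | yes (w , Rw , lt) = w , lt , moves w Rw f feas (λ _ _ _ → refl)
    ... | no none = ⊥-elim (<-irrefl refl (begin-strict
      ∑[ x < n ] (⟦ R x ⟧ * b x)
        <⟨ sum-mono-< (λ x → ⟦⟧*-mono (R x) (λ Rx → ≮⇒≥ (λ lt → none (x , Rx , lt)))) v
             (subst (λ r → ⟦ r ⟧ * b v < ⟦ r ⟧ * exc s t f v) (sym Rv) (*-monoˡ-<-pos 1ℤ over)) ⟩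
      ∑[ x < n ] (⟦ R x ⟧ * exc s t f x)
        ≡⟨ sum-exc s t (λ x → ⟦ R x ⟧) f ⟩
      ∑[ e < m ] ((⟦ R (s e) ⟧ - ⟦ R (t e) ⟧) * f e)
        ≤⟨ sum-mono (λ e → cross-≤ (R (s e)) (R (t e))
             (λ p q → ≮⇒≥ (λ lt → closed e (inj₁ (p , q , lt))))
             (λ p q → ≮⇒≥ (λ lt → closed e (inj₂ (p , q , lt))))) ⟩
      ∑[ e < m ] (cross (R (s e)) (R (t e)) * l e - cross (R (t e)) (R (s e)) * u e)
        ≤⟨ cut R ⟩
      ∑[ x < n ] (⟦ R x ⟧ * b x) ∎))
      where open ≤-Reasoning

    -- Iterates `improve`. The lower bounds `a` survive: `v` was above `b v`, so it stays at or
    -- above it after losing one unit, and `w` only gains.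
    lowerExcess : ∀ (a : Fin n → ℤ) → (∀ v → a v ≤ b v) → ∀ f → Feasible f → (∀ v → a v ≤ exc s t f v) →
      ∃[ h ] Feasible h × (∀ v → a v ≤ exc s t h v × exc s t h v ≤ b v)
    lowerExcess a a≤b f₀ feas₀ a≤f₀ = go (proj₁ fuel) f₀ feas₀ a≤f₀ (proj₂ fuel)
      where
      open ≤-Reasoning
      -- Excesses below `b` count as `b`, so raising `w` does not change this potential while
      -- lowering `v` decreases it. It never falls below `sum b`.
      Φ : (Fin m → ℤ) → ℤ
      Φ f = ∑[ v < n ] (exc s t f v ⊔ b v)
      fuel : ∃[ k ] Φ f₀ ≤ sum b + + k
      fuel = ∣ Φ f₀ - sum b ∣ , (begin
        Φ f₀                               ≡⟨ cancel (Φ f₀) (sum b) ⟩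
        sum b + (Φ f₀ - sum b)             ≤⟨ +-monoʳ-≤ (sum b) (i≤∣i∣ (Φ f₀ - sum b)) ⟩
        sum b + + ∣ Φ f₀ - sum b ∣ ∎)
        where
        cancel : ∀ a b → a ≡ b + (a - b)
        cancel = solve-∀
      go : ∀ k f → Feasible f → (∀ v → a v ≤ exc s t f v) → Φ f ≤ sum b + + k →
        ∃[ h ] Feasible h × (∀ v → a v ≤ exc s t h v × exc s t h v ≤ b v)
      go k f feas a≤f bound with any? (λ v → b v <? exc s t f v)
      ... | no none = f , feas , λ v → a≤f v , ≮⇒≥ (λ lt → none (v , lt))
      go zero f feas a≤f bound | yes (v , over) = ⊥-elim (<-irrefl refl (begin-strict
        sum b         <⟨ sum-mono-< (λ x → i≤j⊔i (exc s t f x) (b x)) v (<-≤-trans over (i≤i⊔j (exc s t f v) (b v))) ⟩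
        Φ f           ≤⟨ bound ⟩
        sum b + 0ℤ    ≡⟨ +-identityʳ (sum b) ⟩
        sum b ∎))
      go (suc k) f feas a≤f bound | yes (v , over) with improve f v feas over
      ... | w , under , h , h-feas , h-exc = go k h h-feas a≤h
        (+-cancelˡ-≤′ (begin
          1ℤ + Φ h             ≤⟨ i<j⇒suc[i]≤j Φh<Φf ⟩
          Φ f                  ≤⟨ bound ⟩
          sum b + (1ℤ + + k)   ≡⟨ shift (sum b) (+ k) ⟩
          1ℤ + (sum b + + k) ∎))
        where
        shift : ∀ a b → a + (1ℤ + b) ≡ 1ℤ + (a + b)
        shift = solve-∀
        +-cancelˡ-≤′ : ∀ {i j} → 1ℤ + i ≤ 1ℤ + j → i ≤ j
        +-cancelˡ-≤′ {i} {j} p = subst₂ _≤_ (drop i) (drop j) (+-monoʳ-≤ (- 1ℤ) p)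
          where
          drop : ∀ i → - 1ℤ + (1ℤ + i) ≡ i
          drop = solve-∀
        v≢w : v ≢ w
        v≢w refl = <-asym over under
        at-v : exc s t h v ≡ exc s t f v - 1ℤ
        at-v = trans (h-exc v) (trans (cong₂ (λ p q → exc s t f v - p + q) (δ-refl v) (δ-≢ (v≢w ∘ sym)))
                 (+-identityʳ _))
        at-w : exc s t h w ≡ 1ℤ + exc s t f w
        at-w = trans (h-exc w) (trans (cong₂ (λ p q → exc s t f w - p + q) (δ-≢ v≢w) (δ-refl w)) (tidy (exc s t f w)))
          where
          tidy : ∀ a → a - 0ℤ + 1ℤ ≡ 1ℤ + a
          tidy = solve-∀
        at-other : ∀ {x} → v ≢ x → w ≢ x → exc s t h x ≡ exc s t f x
        at-other {x} p q = trans (h-exc x) (trans (cong₂ (λ p q → exc s t f x - p + q) (δ-≢ p) (δ-≢ q)) (tidy (exc s t f x)))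
          where
          tidy : ∀ a → a - 0ℤ + 0ℤ ≡ a
          tidy = solve-∀
        v-still : b v ≤ exc s t f v - 1ℤ
        v-still = subst (b v ≤_) (+-comm (- 1ℤ) (exc s t f v)) (i<j⇒i≤pred[j] over)
        v-less : exc s t f v - 1ℤ < exc s t f v
        v-less = subst (_< exc s t f v) (+-comm (- 1ℤ) (exc s t f v)) (i≤pred[j]⇒i<j ≤-refl)
        a≤h : ∀ x → a x ≤ exc s t h x
        a≤h x with v ≟ x | w ≟ x
        ... | yes refl | _        = ≤-trans (a≤b v) (subst (b v ≤_) (sym at-v) v-still)
        ... | no _     | yes refl = ≤-trans (a≤f w) (subst (exc s t f w ≤_) (sym at-w) (i≤suc[i] _))
        ... | no p     | no q     = subst (a x ≤_) (sym (at-other p q)) (a≤f x)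
        h≤ : ∀ x → exc s t h x ≤ exc s t f x ⊔ b x
        h≤ x with v ≟ x | w ≟ x
        ... | yes refl | _        = ≤-trans (≤-reflexive at-v) (≤-trans (<⇒≤ v-less) (i≤i⊔j _ _))
        ... | no _     | yes refl = ≤-trans (≤-reflexive at-w) (≤-trans (i<j⇒suc[i]≤j under) (i≤j⊔i (exc s t f w) (b w)))
        ... | no p     | no q     = ≤-trans (≤-reflexive (at-other p q)) (i≤i⊔j _ _)
        Φh<Φf : Φ h < Φ f
        Φh<Φf = sum-mono-< (λ x → ⊔-lub (h≤ x) (i≤j⊔i (exc s t f x) (b x))) v (begin-strict
          exc s t h v ⊔ b v       ≡⟨ i≥j⇒i⊔j≡i (subst (b v ≤_) (sym at-v) v-still) ⟩
          exc s t h v             ≡⟨ at-v ⟩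
          exc s t f v - 1ℤ        <⟨ v-less ⟩
          exc s t f v             ≤⟨ i≤i⊔j _ _ ⟩
          exc s t f v ⊔ b v ∎)

-- Hoffman's circulation theorem with an interval [a , b] of admissible excesses at every vertex.
opaque
  hoffman : ∀ {n m} (s t : Fin m → Fin n) (l u : Fin m → ℤ) (a b : Fin n → ℤ) →
    (∀ e → l e ≤ u e) → (∀ v → a v ≤ b v) →
    (∀ (R : Fin n → Bool) → ∑[ e < m ] (cross (R (s e)) (R (t e)) * l e - cross (R (t e)) (R (s e)) * u e)
         ≤ ∑[ v < n ] (⟦ R v ⟧ * b v)) →
    (∀ (R : Fin n → Bool) → ∑[ e < m ] (cross (R (t e)) (R (s e)) * l e - cross (R (s e)) (R (t e)) * u e)
         ≤ ∑[ v < n ] (⟦ R v ⟧ * - a v)) →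
    ∃[ f ] (∀ e → l e ≤ f e × f e ≤ u e) × (∀ v → a v ≤ exc s t f v × exc s t f v ≤ b v)
  hoffman s t l u a b l≤u a≤b cut-b cut-a
    -- First the upper bounds. Starting from the flow `l`, the lower bounds in this round are chosen
    -- so that `l` meets them trivially.
    with Flow.lowerExcess s t l u b cut-b (λ v → exc s t l v ⊓ b v) (λ v → i⊓j≤j _ _)
           l (λ e → ≤-refl , l≤u e) (λ v → i⊓j≤i _ _)
  ... | f , f-feas , f-exc
    -- Reversing all edges negates the excesses, so lowering them now enforces `a`, while the bounds
    -- `b` already reached are kept as lower bounds.
    with Flow.lowerExcess t s l u (λ v → - a v) cut-a (λ v → - b v) (λ v → neg-mono-≤ (a≤b v))
           f f-feas (λ v → subst (- b v ≤_) (sym (exc-reverse s t f v)) (neg-mono-≤ (proj₂ (f-exc v))))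
  ... | g , g-feas , g-exc = g , g-feas , λ v →
    neg-cancel-≤ (subst (_≤ - a v) (exc-reverse s t g v) (proj₂ (g-exc v))) ,
    neg-cancel-≤ (subst (- b v ≤_) (exc-reverse s t g v) (proj₁ (g-exc v)))

-- Parity and balanced orientations

odd : ℤ → Bool
odd z = ⌊ z %ℕ 2 N.≟ 1 ⌋

odd-split : ∀ z → z ≡ ⟦ odd z ⟧ + (z /ℕ 2) * + 2
odd-split z = trans (a≡a%ℕn+[a/ℕn]*n z 2) (cong (λ i → i + (z /ℕ 2) * + 2) (digit (n%ℕd<d z 2)))
  where
  digit : ∀ {r} → r N.< 2 → + r ≡ ⟦ ⌊ r N.≟ 1 ⌋ ⟧
  digit {0} _ = refl
  digit {1} _ = refl
  digit {suc (suc r)} (s≤s (s≤s ()))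

odd-congruent : ∀ z → + 2 ∣ z - ⟦ odd z ⟧
odd-congruent z = divides (z /ℕ 2) (trans (cong (_- ⟦ odd z ⟧) (odd-split z)) (cancel ⟦ odd z ⟧ (z /ℕ 2)))
  where
  cancel : ∀ a b → a + b * + 2 - a ≡ b * + 2
  cancel = solve-∀

even⇒¬odd : ∀ {z} → + 2 ∣ z → odd z ≡ false
even⇒¬odd {z} 2∣z with odd z | odd-congruent z
... | false | _     = refl
... | true  | 2∣z-1 = contradiction (ND.∣⇒≤ (∣⇒∣ᵤ (subst (+ 2 ∣_) (cancel z) (∣m∣n⇒∣m-n 2∣z 2∣z-1)))) λ { (s≤s ()) }
  where
  cancel : ∀ z → z - (z - 1ℤ) ≡ 1ℤ
  cancel = solve-∀

¬odd⇒even : ∀ {z} → odd z ≡ false → + 2 ∣ z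
¬odd⇒even {z} eq = subst (+ 2 ∣_) (+-identityʳ z) (subst (λ b → + 2 ∣ z - ⟦ b ⟧) eq (odd-congruent z))

2∣-double : ∀ z → + 2 ∣ z + z
2∣-double z = divides z (double z)
  where
  double : ∀ z → z + z ≡ z * + 2
  double = solve-∀

2∣-sum : ∀ {n} {f : Fin n → ℤ} → (∀ i → + 2 ∣ f i) → + 2 ∣ sum f
2∣-sum {zero}  {f} h = divides 0ℤ (sum-empty f)
2∣-sum {suc n} {f} h = subst (+ 2 ∣_) (sym (sum-suc f)) (∣m∣n⇒∣m+n (h zero) (2∣-sum (h ∘ suc)))

-- The flow with value 1/2 on every edge of S is feasible for these bounds.
half-cut : ∀ {n m} (s t : Fin m → Fin n) (S : Fin m → Bool) (b : Fin n → ℤ) →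
  (∀ v → exc s t (⟦_⟧ ∘ S) v ≤ + 2 * b v) → ∀ R →
  ∑[ e < m ] (cross (R (s e)) (R (t e)) * 0ℤ - cross (R (t e)) (R (s e)) * ⟦ S e ⟧)
    ≤ ∑[ v < n ] (⟦ R v ⟧ * b v)
half-cut {n} {m} s t S b q≤2b R = *-cancelˡ-≤-pos _ _ (+ 2) (begin
  + 2 * ∑[ e < m ] (cross (R (s e)) (R (t e)) * 0ℤ - cross (R (t e)) (R (s e)) * ⟦ S e ⟧)
    ≡⟨ *-distribˡ-sum (+ 2) _ ⟩
  ∑[ e < m ] (+ 2 * (cross (R (s e)) (R (t e)) * 0ℤ - cross (R (t e)) (R (s e)) * ⟦ S e ⟧))
    ≤⟨ sum-mono (λ e → edge (R (s e)) (R (t e)) (S e)) ⟩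
  ∑[ e < m ] ((⟦ R (s e) ⟧ - ⟦ R (t e) ⟧) * ⟦ S e ⟧)
    ≡⟨ sum-exc s t (⟦_⟧ ∘ R) (⟦_⟧ ∘ S) ⟨
  ∑[ v < n ] (⟦ R v ⟧ * exc s t (⟦_⟧ ∘ S) v)
    ≤⟨ sum-mono (λ v → ⟦⟧*-mono (R v) (λ _ → q≤2b v)) ⟩
  ∑[ v < n ] (⟦ R v ⟧ * (+ 2 * b v))
    ≡⟨ sum-cong (λ v → swap ⟦ R v ⟧ (b v)) ⟩
  ∑[ v < n ] (+ 2 * (⟦ R v ⟧ * b v))
    ≡⟨ *-distribˡ-sum (+ 2) _ ⟨
  + 2 * ∑[ v < n ] (⟦ R v ⟧ * b v) ∎)
  where
  open ≤-Reasoning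
  swap : ∀ x y → x * (+ 2 * y) ≡ + 2 * (x * y)
  swap = solve-∀
  edge : ∀ x y σ → + 2 * (cross x y * 0ℤ - cross y x * ⟦ σ ⟧) ≤ (⟦ x ⟧ - ⟦ y ⟧) * ⟦ σ ⟧
  edge true  true  true  = ≤-refl
  edge true  true  false = ≤-refl
  edge true  false true  = +≤+ z≤n
  edge true  false false = ≤-refl
  edge false true  true  = -≤- z≤n
  edge false true  false = ≤-refl
  edge false false true  = ≤-refl
  edge false false false = ≤-refl

-- A sign of 1 keeps the direction from `s` to `t`, and -1 reverses it. In `even`, the excess of the
-- indicator of `S` has the parity of the degree in `S`, because signs do not matter modulo 2.
record BalancedOrientation {n m} (s t : Fin m → Fin n) (S : Fin m → Bool) : Set where
  field
    sign      : Fin m → ℤ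
    sign-on   : ∀ e → S e ≡ true → sign e ≡ 1ℤ ⊎ sign e ≡ - 1ℤ
    sign-off  : ∀ e → S e ≡ false → sign e ≡ 0ℤ
    almost    : ∀ v → - 1ℤ ≤ exc s t sign v × exc s t sign v ≤ 1ℤ
    even      : ∀ v → + 2 ∣ exc s t (⟦_⟧ ∘ S) v → exc s t sign v ≡ 0ℤ

opaque
  -- Half the indicator of `S` is a fractional flow with excess `q / 2`. So `hoffman` yields an
  -- integral `f`, with values 0 and 1 on `S`, whose excess lies between the floor and the ceiling
  -- of `q / 2`. Doubling `f` and subtracting the indicator gives signs whose excess is 0 where `q`
  -- is even and at most 1 in absolute value elsewhere.
  balancedOrientation : ∀ {n m} (s t : Fin m → Fin n) S → BalancedOrientation s t S
  balancedOrientation {n} {m} s t S = fromFlow (hoffman s t (λ _ → 0ℤ) (⟦_⟧ ∘ S) k (λ v → ⟦ odd (q v) ⟧ + k v)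
      (λ e → ⟦⟧≥0 (S e)) (λ v → i≤j+i (k v) _ {{nonNegative (⟦⟧≥0 (odd (q v)))}})
      (half-cut s t S _ upper) (half-cut t s S _ lower))
    where
    q k : Fin n → ℤ
    q = exc s t (⟦_⟧ ∘ S)
    k v = q v /ℕ 2
    open ≤-Reasoning
    upper : ∀ v → q v ≤ + 2 * (⟦ odd (q v) ⟧ + k v)
    upper v = begin
      q v                                           ≡⟨ odd-split (q v) ⟩
      ⟦ odd (q v) ⟧ + k v * + 2                     ≤⟨ i≤j+i _ _ {{nonNegative (⟦⟧≥0 (odd (q v)))}} ⟩
      ⟦ odd (q v) ⟧ + (⟦ odd (q v) ⟧ + k v * + 2)   ≡⟨ tidy ⟦ odd (q v) ⟧ (k v) ⟩
      + 2 * (⟦ odd (q v) ⟧ + k v) ∎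
      where
      tidy : ∀ r k → r + (r + k * + 2) ≡ + 2 * (r + k)
      tidy = solve-∀
    lower : ∀ v → exc t s (⟦_⟧ ∘ S) v ≤ + 2 * - k v
    lower v = begin
      exc t s (⟦_⟧ ∘ S) v           ≡⟨ exc-reverse s t (⟦_⟧ ∘ S) v ⟩
      - q v                         ≡⟨ cong -_ (odd-split (q v)) ⟩
      - (⟦ odd (q v) ⟧ + k v * + 2) ≤⟨ neg-mono-≤ (i≤j+i (k v * + 2) _ {{nonNegative (⟦⟧≥0 (odd (q v)))}}) ⟩
      - (k v * + 2)                 ≡⟨ tidy (k v) ⟩
      + 2 * - k v ∎
      where
      tidy : ∀ k → - (k * + 2) ≡ + 2 * - k
      tidy = solve-∀
    fromFlow : (∃[ f ] (∀ e → 0ℤ ≤ f e × f e ≤ ⟦ S e ⟧)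
                     × (∀ v → k v ≤ exc s t f v × exc s t f v ≤ ⟦ odd (q v) ⟧ + k v)) →
      BalancedOrientation s t S
    fromFlow (f , f-bnd , f-exc) = record
      { sign     = sign
      ; sign-on  = λ e Se → on (f e) (f-bnd e) Se
      ; sign-off = λ e ¬Se → off (f e) (f-bnd e) ¬Se
      ; almost   = λ v → ≤-trans (neg-mono-≤ (⟦⟧-mono {odd (q v)} {true} (λ _ → refl))) (proj₁ (bounds v))
                       , ≤-trans (proj₂ (bounds v)) (⟦⟧-mono {odd (q v)} {true} (λ _ → refl))
      ; even     = λ v 2∣q → ≤-antisym (subst (λ r → exc s t sign v ≤ ⟦ r ⟧) (even⇒¬odd 2∣q) (proj₂ (bounds v)))
                               (subst (λ r → - ⟦ r ⟧ ≤ exc s t sign v) (even⇒¬odd 2∣q) (proj₁ (bounds v)))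
      }
      where
      -- The value is `2 f - 1` on `S`, written as nested sums so that `exc-+` applies.
      sign : Fin m → ℤ
      sign e = f e + (f e + - 1ℤ * ⟦ S e ⟧)
      on : ∀ {σ} z → 0ℤ ≤ z × z ≤ ⟦ σ ⟧ → σ ≡ true →
        z + (z + - 1ℤ * ⟦ σ ⟧) ≡ 1ℤ ⊎ z + (z + - 1ℤ * ⟦ σ ⟧) ≡ - 1ℤ
      on (+ 0) _ refl = inj₂ refl
      on (+ 1) _ refl = inj₁ refl
      on (+ suc (suc _)) (_ , +≤+ (s≤s ())) refl
      off : ∀ {σ} z → 0ℤ ≤ z × z ≤ ⟦ σ ⟧ → σ ≡ false → z + (z + - 1ℤ * ⟦ σ ⟧) ≡ 0ℤ
      off (+ 0) _ refl = refl
      off (+ suc _) (_ , +≤+ ()) refl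
      exc-sign : ∀ v → exc s t sign v ≡ exc s t f v + exc s t f v - q v
      exc-sign v = trans (exc-+ s t f _ v) (trans (cong (_+_ (exc s t f v)) (trans (exc-+ s t f _ v)
          (cong (_+_ (exc s t f v)) (trans (sum-cong (λ e → pull (δ (s e) v - δ (t e) v) ⟦ S e ⟧)) (sum-neg _)))))
        (sym (+-assoc (exc s t f v) (exc s t f v) (- q v))))
        where
        pull : ∀ x y → x * (- 1ℤ * y) ≡ - (x * y)
        pull = solve-∀
      bounds : ∀ v → - ⟦ odd (q v) ⟧ ≤ exc s t sign v × exc s t sign v ≤ ⟦ odd (q v) ⟧
      bounds v = (begin
          - r                          ≡⟨ tidy₁ r (k v) ⟩
          k v + k v - (r + k v * + 2)  ≡⟨ cong (λ i → k v + k v - i) (odd-split (q v)) ⟨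
          k v + k v - q v              ≤⟨ +-monoˡ-≤ (- q v) (+-mono-≤ lo lo) ⟩
          x + x - q v                  ≡⟨ exc-sign v ⟨
          exc s t sign v ∎) , (begin
          exc s t sign v                             ≡⟨ exc-sign v ⟩
          x + x - q v                                ≤⟨ +-monoˡ-≤ (- q v) (+-mono-≤ hi hi) ⟩
          (r + k v) + (r + k v) - q v                ≡⟨ cong (λ i → (r + k v) + (r + k v) - i) (odd-split (q v)) ⟩
          (r + k v) + (r + k v) - (r + k v * + 2)    ≡⟨ tidy₂ r (k v) ⟩
          r ∎)
        where
        r x : ℤ
        r = ⟦ odd (q v) ⟧
        x = exc s t f v
        lo : k v ≤ x
        lo = proj₁ (f-exc v)
        hi : x ≤ r + k v
        hi = proj₂ (f-exc v)
        tidy₁ : ∀ r k → - r ≡ k + k - (r + k * + 2)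
        tidy₁ = solve-∀
        tidy₂ : ∀ r k → (r + k) + (r + k) - (r + k * + 2) ≡ r
        tidy₂ = solve-∀

-- The cut condition for circulations with values from 1 to 4

term≤sum : ∀ {n} {f : Fin n → ℤ} → (∀ i → 0ℤ ≤ f i) → ∀ i → f i ≤ sum f
term≤sum {f = f} f≥0 i = subst (_≤ sum f) (sum-δ i f) (sum-mono (λ j → bound ⌊ i ≟ j ⌋ (f≥0 j)))
  where
  bound : ∀ x {z} → 0ℤ ≤ z → ⟦ x ⟧ * z ≤ z
  bound true  {z} _  = ≤-reflexive (*-identityˡ z)
  bound false z≥0 = z≥0

⟦⟧*-nonneg : ∀ x {z} → 0ℤ ≤ z → 0ℤ ≤ ⟦ x ⟧ * z
⟦⟧*-nonneg true  {z} h = subst (0ℤ ≤_) (sym (*-identityˡ z)) h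
⟦⟧*-nonneg false _ = ≤-refl

cross-not : ∀ x y → cross (not x) (not y) ≡ cross y x
cross-not true  true  = refl
cross-not true  false = refl
cross-not false true  = refl
cross-not false false = refl

-- When the roots are distinct this is the indicator of the roots selected by `o`. As a sum over
-- classes it can be counted over a vertex set by exchanging sums.
marked : ∀ {n k} → (Fin k → Fin n) → (Fin k → Bool) → Fin n → ℤ
marked {k = k} root o v = ∑[ j < k ] (δ (root j) v * ⟦ o j ⟧)

-- tl , hd orient the whole graph so that the edges of F form a circulation, and a is a flow with values
-- 1, 2, 3 except for an excess ε which is at most 1 in absolute value and vanishes outside the roots of odd classes.
module CutCondition {n m k : ℕ} (tl hd : Fin m → Fin n) (F : Fin m → Bool) (a : Fin m → ℤ)
  (1≤a≤3 : ∀ e → 1ℤ ≤ a e × a e ≤ + 3)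
  (circulation : ∀ v → exc tl hd (⟦_⟧ ∘ F) v ≡ 0ℤ)
  (c : Fin n → Fin k)
  (c-F : ∀ e → F e ≡ true → c (tl e) ≡ c (hd e))
  -- Connectivity of the classes through `F`, stated by vertex sets rather than paths: a set whose
  -- boundary contains no edge of `F` cannot split a class.
  (connected : ∀ (Y : Fin n → Bool) → (∀ e → F e ≡ true → Y (tl e) ≡ Y (hd e)) → ∀ x y → c x ≡ c y → Y x ≡ Y y)
  (root : Fin k → Fin n) (c-root : ∀ j → c (root j) ≡ j)
  (o : Fin k → Bool)
  where

  ε : Fin n → ℤ
  ε = exc tl hd a

  roots : Fin n → ℤ
  roots = marked root o

  leaving entering : (Fin n → Bool) → ℤ
  leaving  X = ∑[ e < m ] cross (X (tl e)) (X (hd e))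
  entering X = ∑[ e < m ] cross (X (hd e)) (X (tl e))

  sum-roots : ∀ (h : Fin n → ℤ) → ∑[ v < n ] (h v * roots v) ≡ ∑[ j < k ] (h (root j) * ⟦ o j ⟧)
  sum-roots h = begin
    ∑[ v < n ] (h v * roots v)
      ≡⟨ sum-cong (λ v → trans (*-distribˡ-sum (h v) _) (sum-cong (λ j → swap (h v) (δ (root j) v) ⟦ o j ⟧))) ⟩
    ∑[ v < n ] ∑[ j < k ] (δ (root j) v * (h v * ⟦ o j ⟧))
      ≡⟨ ∑-comm (λ v j → δ (root j) v * (h v * ⟦ o j ⟧)) ⟩
    ∑[ j < k ] ∑[ v < n ] (δ (root j) v * (h v * ⟦ o j ⟧))
      ≡⟨ sum-cong (λ j → sum-δ (root j) (λ v → h v * ⟦ o j ⟧)) ⟩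
    ∑[ j < k ] (h (root j) * ⟦ o j ⟧) ∎
    where
    open ≡-Reasoning
    swap : ∀ x d y → x * (d * y) ≡ d * (x * y)
    swap = solve-∀

  Entering : (Fin n → Bool) → Fin k → Fin m → Set
  Entering X j e = F e ≡ true × c (tl e) ≡ j × X (hd e) ≡ true × X (tl e) ≡ false

  -- Otherwise F, being a circulation, would not leave the part of the class in X either.
  enters : ∀ X {x y} → c x ≡ c y → X x ≡ true → X y ≡ false → ∃[ e ] Entering X (c x) e
  enters X {x} {y} cx≡cy Xx ¬Xy with any? (λ e → (F e B.≟ true) ×-dec ((c (tl e) ≟ c x) ×-dec
                                           ((X (hd e) B.≟ true) ×-dec (X (tl e) B.≟ false))))
  ... | yes found = found
  ... | no none   = contradiction (trans (sym Yx) (trans (connected Y Y-constant x y cx≡cy) Yy)) λ ()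
    where
    Y : Fin n → Bool
    Y v = X v ∧ ⌊ c v ≟ c x ⌋
    Yx : Y x ≡ true
    Yx rewrite Xx with c x ≟ c x
    ... | yes _ = refl
    ... | no ¬p = contradiction refl ¬p
    Yy : Y y ≡ false
    Yy rewrite ¬Xy = refl
    backward : ∀ e → F e ≡ true → Y (hd e) ≡ true → Y (tl e) ≡ true
    backward e Fe with X (hd e) in Xh | X (tl e) in Xt | c (hd e) ≟ c x | c (tl e) ≟ c x
    ... | false | _     | _     | _     = λ ()
    ... | true  | _     | no _  | _     = λ ()
    ... | true  | _     | yes p | no ¬p = contradiction (trans (c-F e Fe) p) ¬p
    ... | true  | true  | yes _ | yes _ = λ _ → refl
    ... | true  | false | yes _ | yes p = contradiction (e , Fe , p , Xh , Xt) none
    nonneg : ∀ f x y → (f ≡ true → y ≡ true → x ≡ true) → 0ℤ ≤ (⟦ x ⟧ - ⟦ y ⟧) * ⟦ f ⟧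
    nonneg true  true  true  _ = ≤-refl
    nonneg true  true  false _ = +≤+ z≤n
    nonneg true  false false _ = ≤-refl
    nonneg true  false true  h = contradiction (h refl refl) λ ()
    nonneg false true  true  _ = ≤-refl
    nonneg false true  false _ = ≤-refl
    nonneg false false true  _ = ≤-refl
    nonneg false false false _ = ≤-refl
    -- The circulation has net outflow 0 from `Y`, and by `backward` no term is negative. Hence
    -- every term vanishes and no edge of `F` crosses the boundary of `Y`.
    total : ∑[ e < m ] ((⟦ Y (tl e) ⟧ - ⟦ Y (hd e) ⟧) * ⟦ F e ⟧) ≡ 0ℤ
    total = trans (sym (sum-exc tl hd (⟦_⟧ ∘ Y) (⟦_⟧ ∘ F)))
      (sum-0 (λ v → trans (cong (_*_ ⟦ Y v ⟧) (circulation v)) (*-zeroʳ ⟦ Y v ⟧)))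
    Y-constant : ∀ e → F e ≡ true → Y (tl e) ≡ Y (hd e)
    Y-constant e Fe = rigid (Y (tl e)) (Y (hd e)) (backward e Fe)
      (subst₂ _≤_ (cong (λ f → (⟦ Y (tl e) ⟧ - ⟦ Y (hd e) ⟧) * ⟦ f ⟧) Fe) total
        (term≤sum (λ e → nonneg (F e) (Y (tl e)) (Y (hd e)) (backward e)) e))
      where
      rigid : ∀ x y → (y ≡ true → x ≡ true) → (⟦ x ⟧ - ⟦ y ⟧) * 1ℤ ≤ 0ℤ → x ≡ y
      rigid true  true  _ _ = refl
      rigid false false _ _ = refl
      rigid false true  h _ = h refl
      rigid true  false _ (+≤+ ())

  Split : (Fin n → Bool) → Fin k → Set
  Split X j = ∃[ x ] ∃[ y ] c x ≡ j × c y ≡ j × X x ≡ true × X y ≡ false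

  -- Entering edges are sorted by the class of their tail. Each class counted on the left is split
  -- by `X`, so `enters` supplies an edge in its own part of the sum. `Z` will be `X` or its
  -- complement.
  roots≤entering : ∀ (X Z : Fin n → Bool) → (∀ j → o j ≡ true → Z (root j) ≡ true → Split X j) →
    ∑[ v < n ] (⟦ Z v ⟧ * roots v) ≤ entering X
  roots≤entering X Z split = begin
    ∑[ v < n ] (⟦ Z v ⟧ * roots v)
      ≡⟨ sum-roots (⟦_⟧ ∘ Z) ⟩
    ∑[ j < k ] (⟦ Z (root j) ⟧ * ⟦ o j ⟧)
      ≤⟨ sum-mono class ⟩
    ∑[ j < k ] ∑[ e < m ] (δ (c (tl e)) j * cross (X (hd e)) (X (tl e)))
      ≡⟨ ∑-comm (λ j e → δ (c (tl e)) j * cross (X (hd e)) (X (tl e))) ⟩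
    ∑[ e < m ] ∑[ j < k ] (δ (c (tl e)) j * cross (X (hd e)) (X (tl e)))
      ≡⟨ sum-cong (λ e → sum-δ (c (tl e)) (λ _ → cross (X (hd e)) (X (tl e)))) ⟩
    entering X ∎
    where
    open ≤-Reasoning
    term : Fin k → Fin m → ℤ
    term j e = δ (c (tl e)) j * cross (X (hd e)) (X (tl e))
    term≥0 : ∀ j e → 0ℤ ≤ term j e
    term≥0 j e = ⟦⟧*-nonneg ⌊ c (tl e) ≟ j ⌋ (⟦⟧≥0 (X (hd e) ∧ not (X (tl e))))
    class : ∀ j → ⟦ Z (root j) ⟧ * ⟦ o j ⟧ ≤ sum (term j)
    class j with Z (root j) in Zr | o j in oj
    ... | false | _     = sum-nonneg (term≥0 j)
    ... | true  | false = sum-nonneg (term≥0 j)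
    ... | true  | true with split j oj Zr
    ... | x , y , refl , cy , Xx , ¬Xy with enters X (sym cy) Xx ¬Xy
    ... | e , _ , ce , Xh , ¬Xt = ≤-trans (≤-reflexive (sym unit)) (term≤sum (term≥0 (c x)) e)
      where
      unit : term (c x) e ≡ 1ℤ
      unit = cong₂ _*_ (trans (cong (λ j → δ j (c x)) ce) (δ-refl (c x))) (cong₂ cross Xh ¬Xt)

  -- The excess of `X` is its net outflow under `a`, where leaving edges carry at least 1 and
  -- entering edges at most 3.
  leaving≤ : ∀ X → leaving X ≤ + 3 * entering X + ∑[ v < n ] (⟦ X v ⟧ * ε v)
  leaving≤ X = begin
    leaving X
      ≤⟨ sum-mono (λ e → edge (X (tl e)) (X (hd e)) (1≤a≤3 e)) ⟩
    ∑[ e < m ] (+ 3 * cross (X (hd e)) (X (tl e)) + (⟦ X (tl e) ⟧ - ⟦ X (hd e) ⟧) * a e)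
      ≡⟨ ∑-distrib-+ _ _ ⟩
    ∑[ e < m ] (+ 3 * cross (X (hd e)) (X (tl e))) + ∑[ e < m ] ((⟦ X (tl e) ⟧ - ⟦ X (hd e) ⟧) * a e)
      ≡⟨ cong₂ _+_ (*-distribˡ-sum (+ 3) _) (sum-exc tl hd (⟦_⟧ ∘ X) a) ⟨
    + 3 * entering X + ∑[ v < n ] (⟦ X v ⟧ * ε v) ∎
    where
    open ≤-Reasoning
    edge : ∀ x y {z} → 1ℤ ≤ z × z ≤ + 3 → cross x y ≤ + 3 * cross y x + (⟦ x ⟧ - ⟦ y ⟧) * z
    edge true  true  _ = ≤-refl
    edge false false _ = ≤-refl
    edge true  false {z} (1≤z , _) = subst (1ℤ ≤_) (tidy z) 1≤z
      where
      tidy : ∀ z → z ≡ + 3 * 0ℤ + (1ℤ - 0ℤ) * z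
      tidy = solve-∀
    edge false true  {z} (_ , z≤3) = subst (0ℤ ≤_) (tidy z) (i≤j⇒0≤j-i z≤3)
      where
      tidy : ∀ z → + 3 - z ≡ + 3 * 1ℤ + (0ℤ - 1ℤ) * z
      tidy = solve-∀

  ε-complement : ∀ X → ∑[ v < n ] (⟦ not (X v) ⟧ * ε v) ≡ - ∑[ v < n ] (⟦ X v ⟧ * ε v)
  ε-complement X = trans (sum-exc tl hd (⟦_⟧ ∘ not ∘ X) a) (trans (sum-cong (λ e → edge (X (tl e)) (X (hd e)) (a e)))
    (trans (sum-neg _) (cong -_ (sym (sum-exc tl hd (⟦_⟧ ∘ X) a)))))
    where
    edge : ∀ x y z → (⟦ not x ⟧ - ⟦ not y ⟧) * z ≡ - ((⟦ x ⟧ - ⟦ y ⟧) * z)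
    edge true  true  z = refl
    edge false false z = refl
    edge true  false z = tidy z
      where
      tidy : ∀ z → (0ℤ - 1ℤ) * z ≡ - ((1ℤ - 0ℤ) * z)
      tidy = solve-∀
    edge false true  z = tidy z
      where
      tidy : ∀ z → (1ℤ - 0ℤ) * z ≡ - ((0ℤ - 1ℤ) * z)
      tidy = solve-∀

  module _ (|ε|≤roots : ∀ v → - roots v ≤ ε v × ε v ≤ roots v)
    (separated : ∀ X i j → o i ≡ true → o j ≡ true →
      (∀ v → c v ≡ i → X v ≡ true) → (∀ v → c v ≡ j → X v ≡ false) →
      + 5 * ∑[ j < k ] ⟦ o j ⟧ ≤ + 2 * (entering X + leaving X) + + 2) where

    -- The complement has the opposite excess. So twice the excess of `X` is a signed sum of all
    -- `ε v`, bounded by the number of roots of odd classes.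
    excess≤half : ∀ X → + 2 * ∑[ v < n ] (⟦ X v ⟧ * ε v) ≤ ∑[ j < k ] ⟦ o j ⟧
    excess≤half X = begin
      + 2 * K
        ≡⟨ tidy K ⟩
      K - - K
        ≡⟨ cong (λ i → K - i) (ε-complement X) ⟨
      K - ∑[ v < n ] (⟦ not (X v) ⟧ * ε v)
        ≡⟨ sum-diff _ _ ⟨
      ∑[ v < n ] (⟦ X v ⟧ * ε v - ⟦ not (X v) ⟧ * ε v)
        ≤⟨ sum-mono (λ v → abs (X v) (|ε|≤roots v)) ⟩
      ∑[ v < n ] (1ℤ * roots v)
        ≡⟨ sum-roots (λ _ → 1ℤ) ⟩
      ∑[ j < k ] (1ℤ * ⟦ o j ⟧)
        ≡⟨ sum-cong (λ j → *-identityˡ ⟦ o j ⟧) ⟩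
      ∑[ j < k ] ⟦ o j ⟧ ∎
      where
      open ≤-Reasoning
      K = ∑[ v < n ] (⟦ X v ⟧ * ε v)
      tidy : ∀ z → + 2 * z ≡ z - - z
      tidy = solve-∀
      abs : ∀ x {z w} → - w ≤ z × z ≤ w → ⟦ x ⟧ * z - ⟦ not x ⟧ * z ≤ 1ℤ * w
      abs true {z} {w} (_ , h) = subst₂ _≤_ (tidy₁ z) (sym (*-identityˡ w)) h
        where
        tidy₁ : ∀ z → z ≡ 1ℤ * z - 0ℤ * z
        tidy₁ = solve-∀
      abs false {z} {w} (h , _) = subst₂ _≤_ (tidy₂ z) (trans (neg-involutive w) (sym (*-identityˡ w))) (neg-mono-≤ h)
        where
        tidy₂ : ∀ z → - z ≡ 0ℤ * z - 1ℤ * z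
        tidy₂ = solve-∀

    Within : (Fin n → Bool) → Bool → Fin k → Set
    Within X b j = o j ≡ true × (∀ v → c v ≡ j → X v ≡ b)

    within? : ∀ X b j → Dec (Within X b j)
    within? X b j = (o j B.≟ true) ×-dec all? (λ v → (c v ≟ j) →-dec (X v B.≟ b))

    escape : ∀ (X : Fin n → Bool) b j → ¬ (∀ v → c v ≡ j → X v ≡ b) → ∃[ y ] c y ≡ j × X y ≡ not b
    escape X b j ¬all with ¬∀⟶∃¬ n (λ v → c v ≡ j → X v ≡ b) (λ v → (c v ≟ j) →-dec (X v B.≟ b)) ¬all
    ... | y , ¬h with c y ≟ j
    ... | no ¬p = contradiction (λ p → contradiction p ¬p) ¬h
    ... | yes p = y , p , flip (X y) b (λ q → ¬h (λ _ → q))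
      where
      flip : ∀ x b → x ≢ b → x ≡ not b
      flip true  true  h = contradiction refl h
      flip true  false h = refl
      flip false true  h = refl
      flip false false h = contradiction refl h

    -- If no odd class lies inside `X`, every odd class with its root in `X` is split, and the
    -- positive excess is at most the number of such roots. If none lies outside, the same count is
    -- made for roots in the complement, whose excess is opposite. In both cases a split class has
    -- an edge entering `X`, because `F` is a circulation.
    excess≤entering : ∀ X → (¬ ∃ (Within X true)) ⊎ (¬ ∃ (Within X false)) → ∑[ v < n ] (⟦ X v ⟧ * ε v) ≤ entering X
    excess≤entering X (inj₁ noInside) = ≤-trans (sum-mono (λ v → ⟦⟧*-mono (X v) (λ _ → proj₂ (|ε|≤roots v))))
      (roots≤entering X X split)
      where
      split : ∀ j → o j ≡ true → X (root j) ≡ true → Split X j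
      split j oj Xr with escape X true j (λ all → noInside (j , oj , all))
      ... | y , cy , ¬Xy = root j , y , c-root j , cy , Xr , ¬Xy
    excess≤entering X (inj₂ noOutside) = begin
      ∑[ v < n ] (⟦ X v ⟧ * ε v)               ≡⟨ neg-involutive _ ⟨
      - - ∑[ v < n ] (⟦ X v ⟧ * ε v)           ≡⟨ cong -_ (ε-complement X) ⟨
      - ∑[ v < n ] (⟦ not (X v) ⟧ * ε v)       ≡⟨ sum-neg _ ⟨
      ∑[ v < n ] (- (⟦ not (X v) ⟧ * ε v))     ≤⟨ sum-mono (λ v → abs (not (X v)) (proj₁ (|ε|≤roots v))) ⟩
      ∑[ v < n ] (⟦ not (X v) ⟧ * roots v)     ≤⟨ roots≤entering X (not ∘ X) split ⟩
      entering X ∎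
      where
      open ≤-Reasoning
      abs : ∀ x {z w} → - w ≤ z → - (⟦ x ⟧ * z) ≤ ⟦ x ⟧ * w
      abs true  {z} {w} h = subst₂ _≤_ (cong -_ (sym (*-identityˡ z))) (trans (neg-involutive w) (sym (*-identityˡ w))) (neg-mono-≤ h)
      abs false _ = ≤-refl
      split : ∀ j → o j ≡ true → not (X (root j)) ≡ true → Split X j
      split j oj ¬Xr with escape X false j (λ all → noOutside (j , oj , all)) | X (root j) in eq
      ... | y , cy , Xy | false = y , root j , cy , c-root j , Xy , eq
      split j oj () | _ | true

    leaving≤4entering : ∀ X → leaving X ≤ + 4 * entering X
    leaving≤4entering X = conclude (∑[ v < n ] (⟦ X v ⟧ * ε v) ≤? entering X)
      where
      open ≤-Reasoning
      K I O ω : ℤ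
      K = ∑[ v < n ] (⟦ X v ⟧ * ε v)
      I = entering X
      O = leaving X
      ω = ∑[ j < k ] ⟦ o j ⟧
      tidy : ∀ i → + 3 * i + i ≡ + 4 * i
      tidy = solve-∀
      -- If `K` exceeds `I` and odd classes lie on both sides, all four brackets are nonnegative.
      -- The multipliers 2, 8, 5 and 1 cancel every variable and leave -6, a contradiction.
      combine : ∀ k i o ω → + 2 * (+ 3 * i + k - o) + + 8 * (k - (1ℤ + i)) + + 5 * (ω - + 2 * k)
                  + (+ 2 * (i + o) + + 2 - + 5 * ω) ≡ - + 6
      combine = solve-∀
      scale : ∀ q {z} → 0ℤ ≤ z → 0ℤ ≤ + q * z
      scale q {z} h = subst (_≤ + q * z) (*-zeroʳ (+ q)) (*-monoˡ-≤-nonNeg (+ q) h)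
      conclude : Dec (K ≤ I) → O ≤ + 4 * I
      conclude (yes K≤I) = begin
        O                ≤⟨ leaving≤ X ⟩
        + 3 * I + K      ≤⟨ +-monoʳ-≤ (+ 3 * I) K≤I ⟩
        + 3 * I + I      ≡⟨ tidy I ⟩
        + 4 * I ∎
      conclude (no K≰I) with any? (within? X true) | any? (within? X false)
      ... | no none | _ = contradiction (excess≤entering X (inj₁ none)) K≰I
      ... | yes _ | no none = contradiction (excess≤entering X (inj₂ none)) K≰I
      ... | yes (i , oi , inside) | yes (j , oj , outside) =
        contradiction (subst (0ℤ ≤_) (combine K I O ω)
          (+-mono-≤ (+-mono-≤ (+-mono-≤
            (scale 2 (i≤j⇒0≤j-i (leaving≤ X)))
            (scale 8 (i≤j⇒0≤j-i (i<j⇒suc[i]≤j (≰⇒> K≰I)))))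
            (scale 5 (i≤j⇒0≤j-i (excess≤half X))))
            (i≤j⇒0≤j-i (separated X i j oi oj inside outside)))) λ ()

    -- For bounds 1 and 4 and excess 0, the first condition of `hoffman` is `leaving≤4entering`. The
    -- second is the first for the complement.
    circulation₁₄ : ∃[ f ] (∀ e → 1ℤ ≤ f e × f e ≤ + 4) × (∀ v → exc tl hd f v ≡ 0ℤ)
    circulation₁₄ = widen (hoffman tl hd (λ _ → 1ℤ) (λ _ → + 4) (λ _ → 0ℤ) (λ _ → 0ℤ)
        (λ _ → +≤+ (s≤s z≤n)) (λ _ → ≤-refl) cut cut′)
      where
      zeros : ∀ X → ∑[ v < n ] (⟦ X v ⟧ * 0ℤ) ≡ 0ℤ
      zeros X = sum-0 (λ v → *-zeroʳ ⟦ X v ⟧)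
      cut : ∀ X → ∑[ e < m ] (cross (X (tl e)) (X (hd e)) * 1ℤ - cross (X (hd e)) (X (tl e)) * + 4)
                ≤ ∑[ v < n ] (⟦ X v ⟧ * 0ℤ)
      cut X = begin
        ∑[ e < m ] (cross (X (tl e)) (X (hd e)) * 1ℤ - cross (X (hd e)) (X (tl e)) * + 4)
          ≡⟨ sum-cong (λ e → tidy (cross (X (tl e)) (X (hd e))) (cross (X (hd e)) (X (tl e)))) ⟩
        ∑[ e < m ] (cross (X (tl e)) (X (hd e)) - + 4 * cross (X (hd e)) (X (tl e)))
          ≡⟨ trans (sum-diff _ _) (cong (λ i → leaving X - i) (sym (*-distribˡ-sum (+ 4) _))) ⟩
        leaving X - + 4 * entering X
          ≤⟨ i≤j⇒i-j≤0 (leaving≤4entering X) ⟩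
        0ℤ
          ≡⟨ zeros X ⟨
        ∑[ v < n ] (⟦ X v ⟧ * 0ℤ) ∎
        where
        open ≤-Reasoning
        tidy : ∀ x y → x * 1ℤ - y * + 4 ≡ x - + 4 * y
        tidy = solve-∀
      complement : ∀ x y → cross y x * 1ℤ - cross x y * + 4
                         ≡ cross (not x) (not y) * 1ℤ - cross (not y) (not x) * + 4
      complement x y = sym (cong₂ (λ i j → i * 1ℤ - j * + 4) (cross-not x y) (cross-not y x))
      cut′ : ∀ X → ∑[ e < m ] (cross (X (hd e)) (X (tl e)) * 1ℤ - cross (X (tl e)) (X (hd e)) * + 4)
                 ≤ ∑[ v < n ] (⟦ X v ⟧ * 0ℤ)
      cut′ X = ≤-trans (≤-reflexive (sum-cong (λ e → complement (X (tl e)) (X (hd e)))))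
        (≤-trans (cut (not ∘ X)) (≤-reflexive (trans (zeros (not ∘ X)) (sym (zeros X)))))
      widen : (∃[ f ] (∀ e → 1ℤ ≤ f e × f e ≤ + 4) × (∀ v → 0ℤ ≤ exc tl hd f v × exc tl hd f v ≤ 0ℤ)) →
        ∃[ f ] (∀ e → 1ℤ ≤ f e × f e ≤ + 4) × (∀ v → exc tl hd f v ≡ 0ℤ)
      widen (f , bnd , exc-f) = f , bnd , λ v → ≤-antisym (proj₂ (exc-f v)) (proj₁ (exc-f v))

-- Graph notions as integer sums

card-sum : ∀ {n} (p : Subset n) → + card p ≡ ∑[ i < n ] ⟦ lookup p i ⟧
card-sum []          = sym (sum-empty _)
card-sum (true  ∷ p) = trans (cong (_+_ 1ℤ) (card-sum p)) (sym (sum-suc _))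
card-sum (false ∷ p) = trans (card-sum p) (sym (trans (sum-suc _) (+-identityˡ _)))

card-tabulate : ∀ {n} (f : Fin n → Bool) → + card (tabulate f) ≡ ∑[ i < n ] ⟦ f i ⟧
card-tabulate f = trans (card-sum (tabulate f)) (sum-cong (λ i → cong ⟦_⟧ (lookup∘tabulate f i)))

∉⇒false : ∀ {n} {p : Subset n} {i} → i ∉ p → lookup p i ≡ false
∉⇒false {p = p} {i} i∉p with lookup p i in eq
... | true  = contradiction (lookup⇒[]= i p eq) i∉p
... | false = refl

sum-if : ∀ {n} (b : Fin n → Bool) (g : Fin n → ℕ) →
  + LA.sum (L.tabulate (λ e → if b e then g e else 0)) ≡ ∑[ e < n ] (⟦ b e ⟧ * + g e)
sum-if {zero}  b g = sym (sum-empty _)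
sum-if {suc n} b g = trans (cong₂ _+_ (first (b zero)) (sum-if (b ∘ suc) (g ∘ suc))) (sym (sum-suc _))
  where
  first : ∀ x → + (if x then g zero else 0) ≡ ⟦ x ⟧ * + g zero
  first true  = sym (*-identityˡ (+ g zero))
  first false = refl

toFin₅ : ∀ {z} → 1ℤ ≤ z × z ≤ + 4 → ∃[ i ] + Fin.toℕ {5} i ≡ z × Fin.toℕ {5} i ≢ 0
toFin₅ {+ k}     (+≤+ 1≤k , +≤+ k≤4) = Fin.fromℕ< (s≤s k≤4) , cong +_ (toℕ-fromℕ< (s≤s k≤4)) ,
  λ eq → contradiction (subst (1 N.≤_) (trans (sym (toℕ-fromℕ< (s≤s k≤4))) eq) 1≤k) λ ()
toFin₅ { -[1+ k ]} (() , _)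

module _ (G : Graph) where

  private
    V E : Set
    V = Fin (n G)
    E = Fin (m G)
    s t : E → V
    s = end₁ G
    t = end₂ G

  circulation⇒flow : ∀ (D : E → Bool) (f : E → ℤ) → (∀ e → 1ℤ ≤ f e × f e ≤ + 4) →
    (∀ v → exc (tail G D) (head G D) f v ≡ 0ℤ) → NowhereZeroFlow G 5
  circulation⇒flow D f bnd circ = D , (λ e → proj₁ (φ e)) , (λ e → proj₂ (proj₂ (φ e))) , λ v →
    +-injective (i-j≡0⇒i≡j _ _ (begin
      + sumE G (λ e → if ⌊ tail G D e ≟ v ⌋ then ∣φ∣ e else 0)
        - + sumE G (λ e → if ⌊ head G D e ≟ v ⌋ then ∣φ∣ e else 0)
        ≡⟨ cong₂ _-_ (sum-if _ ∣φ∣) (sum-if _ ∣φ∣) ⟩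
      ∑[ e < m G ] (δ (tail G D e) v * + ∣φ∣ e) - ∑[ e < m G ] (δ (head G D e) v * + ∣φ∣ e)
        ≡⟨ sum-diff _ _ ⟨
      ∑[ e < m G ] (δ (tail G D e) v * + ∣φ∣ e - δ (head G D e) v * + ∣φ∣ e)
        ≡⟨ sum-cong (λ e → trans (factor (δ (tail G D e) v) (δ (head G D e) v) (+ ∣φ∣ e))
             (cong (_*_ (δ (tail G D e) v - δ (head G D e) v)) (proj₁ (proj₂ (φ e))))) ⟩
      exc (tail G D) (head G D) f v
        ≡⟨ circ v ⟩
      0ℤ ∎))
    where
    open ≡-Reasoning
    φ : ∀ e → ∃[ i ] + Fin.toℕ {5} i ≡ f e × Fin.toℕ {5} i ≢ 0
    φ e = toFin₅ (bnd e)
    ∣φ∣ : E → ℕ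
    ∣φ∣ e = Fin.toℕ (proj₁ (φ e))
    factor : ∀ a b x → a * x - b * x ≡ (a - b) * x
    factor = solve-∀

  path-constant : ∀ {S} {A : Set} (f : V → A) → (∀ e → e ∈ S → f (s e) ≡ f (t e)) →
    ∀ {x y} → Path G S x y → f x ≡ f y
  path-constant f h here          = refl
  path-constant f h (step₁ e e∈ p) = trans (h e e∈) (path-constant f h p)
  path-constant f h (step₂ e e∈ p) = trans (sym (h e e∈)) (path-constant f h p)

  deg : (E → ℤ) → V → ℤ
  deg f v = ∑[ e < m G ] ((δ (s e) v + δ (t e) v) * f e)

  deg-+ : ∀ f g v → deg (λ e → f e + g e) v ≡ deg f v + deg g v
  deg-+ f g v = trans (sum-cong (λ e → *-distribˡ-+ (δ (s e) v + δ (t e) v) (f e) (g e))) (∑-distrib-+ _ _)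

  deg-δ : ∀ a v → deg (δ a) v ≡ δ (s a) v + δ (t a) v
  deg-δ a v = trans (sum-cong (λ e → *-comm (δ (s e) v + δ (t e) v) (δ a e))) (sum-δ a _)

  deg-sum : ∀ {k} (f : Fin k → E → ℤ) v → deg (λ e → ∑[ i < k ] f i e) v ≡ ∑[ i < k ] deg (f i) v
  deg-sum f v = trans (sum-cong (λ e → *-distribˡ-sum (δ (s e) v + δ (t e) v) _)) (∑-comm _)

  deg-congruent : ∀ f g → (∀ e → + 2 ∣ f e - g e) → ∀ v → + 2 ∣ deg f v - deg g v
  deg-congruent f g f≡g v = subst (+ 2 ∣_) (sum-diff _ _) (2∣-sum (λ e →
    subst (+ 2 ∣_) (expand (δ (s e) v + δ (t e) v) (f e) (g e)) (∣n⇒∣m*n (δ (s e) v + δ (t e) v) (f≡g e))))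
    where
    expand : ∀ x a b → x * (a - b) ≡ x * a - x * b
    expand = solve-∀

  -- The difference between `deg` and `exc` counts the contribution of each head twice.
  even-deg⇒even-exc : ∀ f v → + 2 ∣ deg f v → + 2 ∣ exc s t f v
  even-deg⇒even-exc f v 2∣deg = subst (+ 2 ∣_) (cancel (deg f v) (exc s t f v)) (∣m∣n⇒∣m-n 2∣deg
    (subst (+ 2 ∣_) (sum-diff _ _) (2∣-sum (λ e → subst (+ 2 ∣_) (twice (δ (s e) v) (δ (t e) v) (f e))
      (2∣-double (δ (t e) v * f e))))))
    where
    twice : ∀ a b x → b * x + b * x ≡ (a + b) * x - (a - b) * x
    twice = solve-∀
    cancel : ∀ d x → d - (d - x) ≡ x
    cancel = solve-∀

  -- The disjunction in `incident` agrees with the sum of both ends in `deg` because no edge is a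
  -- loop.
  degIn-sum : ∀ S v → + degIn G S v ≡ deg (λ e → ⟦ lookup S e ⟧) v
  degIn-sum S v = trans (card-sum (incident G v ∩ S)) (sum-cong edge)
    where
    edge : ∀ e → ⟦ lookup (incident G v ∩ S) e ⟧ ≡ (δ (s e) v + δ (t e) v) * ⟦ lookup S e ⟧
    edge e rewrite lookup-zipWith _∧_ e (incident G v) S
                 | lookup∘tabulate (λ e → ⌊ s e ≟ v ⌋ ∨ ⌊ t e ≟ v ⌋) e
      with s e ≟ v | t e ≟ v | lookup S e
    ... | yes p | yes q | _     = contradiction (trans p (sym q)) (loopless G e)
    ... | yes _ | no _  | true  = refl
    ... | yes _ | no _  | false = refl
    ... | no _  | yes _ | true  = refl
    ... | no _  | yes _ | false = refl
    ... | no _  | no _  | _     = refl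

  -- Degrees of walks modulo 2

  uses : ∀ {S x y} → Path G S x y → E → ℤ
  uses here          _  = 0ℤ
  uses (step₁ e _ p) e′ = δ e e′ + uses p e′
  uses (step₂ e _ p) e′ = δ e e′ + uses p e′

  uses-outside : ∀ {S x y} (p : Path G S x y) {e} → e ∉ S → uses p e ≡ 0ℤ
  uses-outside here           e∉S = refl
  uses-outside (step₁ e e∈ p) {e′} e∉S = cong₂ _+_ (δ-≢ {x = e} {e′} λ { refl → e∉S e∈ }) (uses-outside p e∉S)
  uses-outside (step₂ e e∈ p) {e′} e∉S = cong₂ _+_ (δ-≢ {x = e} {e′} λ { refl → e∉S e∈ }) (uses-outside p e∉S)

  -- Prepending an edge adds both its ends, which modulo 2 replaces the old starting vertex by the
  -- new one. Repeated edges are harmless, since `uses` counts multiplicity.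
  deg-uses : ∀ {S x y} (p : Path G S x y) v → + 2 ∣ deg (uses p) v - (δ x v + δ y v)
  deg-uses {x = x} here v = subst (λ d → + 2 ∣ d - (δ x v + δ x v))
    (sym (sum-0 (λ e → *-zeroʳ (δ (s e) v + δ (t e) v))))
    (subst (+ 2 ∣_) (sym (+-identityˡ _)) (∣m⇒∣-m (2∣-double (δ x v))))
  deg-uses {y = y} (step₁ e _ p) v = subst (+ 2 ∣_)
    (trans (regroup (δ (s e) v) (δ (t e) v) (deg (uses p) v) (δ y v))
      (cong (_- (δ (s e) v + δ y v)) (sym (trans (deg-+ _ _ v) (cong (_+ deg (uses p) v) (deg-δ e v))))))
    (∣m∣n⇒∣m+n (deg-uses p v) (2∣-double (δ (t e) v)))
    where
    regroup : ∀ a b d y → (d - (b + y)) + (b + b) ≡ ((a + b) + d) - (a + y)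
    regroup = solve-∀
  deg-uses {y = y} (step₂ e _ p) v = subst (+ 2 ∣_)
    (trans (regroup (δ (s e) v) (δ (t e) v) (deg (uses p) v) (δ y v))
      (cong (_- (δ (t e) v + δ y v)) (sym (trans (deg-+ _ _ v) (cong (_+ deg (uses p) v) (deg-δ e v))))))
    (∣m∣n⇒∣m+n (deg-uses p v) (2∣-double (δ (s e) v)))
    where
    regroup : ∀ a b d y → (d - (a + y)) + (a + a) ≡ ((a + b) + d) - (b + y)
    regroup = solve-∀

-- A common orientation from two sets of signs

δ-sym : ∀ {n} (x y : Fin n) → δ x y ≡ δ y x
δ-sym x y with x ≟ y
... | yes refl = sym (δ-refl x)
... | no x≢y   = sym (δ-≢ (x≢y ∘ sym))

signed : Bool → ℤ → ℤ
signed true  z = z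
signed false z = - z

-- The common orientation of an edge, from its sign g in F and its sign h in J, where F ∪ J is everything.
orientEdge : ∀ {σ} g h → (σ ≡ true → g ≡ 1ℤ ⊎ g ≡ - 1ℤ) → (σ ≡ false → g ≡ 0ℤ) →
  h ≡ 1ℤ ⊎ h ≡ - 1ℤ ⊎ (σ ≡ true × h ≡ 0ℤ) →
  ∃[ D ] g ≡ signed D ⟦ σ ⟧ × ∃[ a ] g + (g + h) ≡ signed D a × (1ℤ ≤ a × a ≤ + 3)
orientEdge {true} g h on _ h-val with on refl | h-val
... | inj₁ refl | inj₁ refl                 = true  , refl , + 3 , refl , +≤+ (s≤s z≤n) , ≤-refl
... | inj₁ refl | inj₂ (inj₁ refl)          = true  , refl , + 1 , refl , ≤-refl , +≤+ (s≤s z≤n)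
... | inj₁ refl | inj₂ (inj₂ (_ , refl))    = true  , refl , + 2 , refl , +≤+ (s≤s z≤n) , +≤+ (s≤s (s≤s z≤n))
... | inj₂ refl | inj₁ refl                 = false , refl , + 1 , refl , ≤-refl , +≤+ (s≤s z≤n)
... | inj₂ refl | inj₂ (inj₁ refl)          = false , refl , + 3 , refl , +≤+ (s≤s z≤n) , ≤-refl
... | inj₂ refl | inj₂ (inj₂ (_ , refl))    = false , refl , + 2 , refl , +≤+ (s≤s z≤n) , +≤+ (s≤s (s≤s z≤n))
orientEdge {false} g h _ off h-val with off refl | h-val
... | refl | inj₁ refl                = true  , refl , + 1 , refl , ≤-refl , +≤+ (s≤s z≤n)
... | refl | inj₂ (inj₁ refl)         = false , refl , + 1 , refl , ≤-refl , +≤+ (s≤s z≤n)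
... | refl | inj₂ (inj₂ (() , _))

-- Reversing an edge and negating its value leave all excesses unchanged.
exc-oriented : ∀ (G : Graph) D (f g : Fin (m G) → ℤ) → (∀ e → f e ≡ signed (D e) (g e)) →
  ∀ v → exc (tail G D) (head G D) g v ≡ exc (end₁ G) (end₂ G) f v
exc-oriented G D f g f≡ v = sum-cong λ e →
  trans (edge (D e) (end₁ G e) (end₂ G e) (g e)) (cong (_*_ (δ (end₁ G e) v - δ (end₂ G e) v)) (sym (f≡ e)))
  where
  swap : ∀ a b z → (b - a) * z ≡ (a - b) * - z
  swap = solve-∀
  edge : ∀ d x y z → (δ (if d then x else y) v - δ (if d then y else x) v) * z ≡ (δ x v - δ y v) * signed d z
  edge true  x y z = refl
  edge false x y z = swap (δ x v) (δ y v) z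

-- The flow with values 1, 2, 3 obtained from a 2-factor

module WithTwoFactor (G : Graph) (cubic : Cubic G) (F : Subset (m G)) (2-factor : TwoFactor G F)
  {k : ℕ} (c : Fin (n G) → Fin k) (labelling : IsComponentLabelling G F k c) where

  private
    V E : Set
    V = Fin (n G)
    E = Fin (m G)
    s t : E → V
    s = end₁ G
    t = end₂ G

    c-edge : ∀ e → e ∈ F → c (s e) ≡ c (t e)
    c-edge = proj₁ labelling
    path : ∀ x y → c x ≡ c y → Path G F x y
    path = proj₁ (proj₂ labelling)

  inF : E → Bool
  inF = lookup F

  root : Fin k → V
  root j = proj₁ (proj₂ (proj₂ labelling) j)
  c-root : ∀ j → c (root j) ≡ j
  c-root j = proj₂ (proj₂ (proj₂ labelling) j)

  o : Fin k → Bool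
  o j = odd (+ classSize G c j)

  toRoot : ∀ u → Path G F u (root (c u))
  toRoot u = path u (root (c u)) (sym (c-root (c u)))

  traffic : E → ℤ
  traffic e = ∑[ u < n G ] uses G (toRoot u) e

  -- A path to its root from every vertex: modulo 2 this selects a set of edges of F of odd degree
  -- everywhere except at the roots of the odd classes.
  inN : E → Bool
  inN e = odd (traffic e)

  N⊆F : ∀ e → inF e ≡ false → inN e ≡ false
  N⊆F e ¬Fe = cong odd (sum-0 (λ u → uses-outside G (toRoot u) λ e∈F →
    contradiction (trans (sym ([]=⇒lookup e∈F)) ¬Fe) λ ()))

  inJ : E → Bool
  inJ e = not (inF e) ∨ inN e

  -- The complement of `F` has degree 3 - 2 = 1 at every vertex, and it is disjoint from `inN` by
  -- `N⊆F`.
  deg-J : ∀ v → deg G (⟦_⟧ ∘ inJ) v ≡ 1ℤ + deg G (⟦_⟧ ∘ inN) v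
  deg-J v = begin
    deg G (⟦_⟧ ∘ inJ) v
      ≡⟨ sum-cong (λ e → trans (cong (_*_ (w e)) (edge (inF e) (inN e) (N⊆F e))) (expand (w e) ⟦ inF e ⟧ ⟦ inN e ⟧)) ⟩
    ∑[ e < m G ] ((w e * 1ℤ - w e * ⟦ inF e ⟧) + w e * ⟦ inN e ⟧)
      ≡⟨ trans (∑-distrib-+ _ _) (cong (_+ deg G (⟦_⟧ ∘ inN) v) (sum-diff _ _)) ⟩
    ∑[ e < m G ] (w e * 1ℤ) - deg G (⟦_⟧ ∘ inF) v + deg G (⟦_⟧ ∘ inN) v
      ≡⟨ cong₂ (λ i j → i - j + deg G (⟦_⟧ ∘ inN) v) three two ⟩
    1ℤ + deg G (⟦_⟧ ∘ inN) v ∎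
    where
    open ≡-Reasoning
    w : E → ℤ
    w e = δ (s e) v + δ (t e) v
    three : ∑[ e < m G ] (w e * 1ℤ) ≡ + 3
    three = trans (sum-cong (λ e → cong (λ b → w e * ⟦ b ⟧) (sym (lookup-replicate e true))))
              (trans (sym (degIn-sum G ⊤ v)) (cong +_ (cubic v)))
    two : deg G (⟦_⟧ ∘ inF) v ≡ + 2
    two = trans (sym (degIn-sum G F v)) (cong +_ (2-factor v))
    edge : ∀ f x → (f ≡ false → x ≡ false) → ⟦ not f ∨ x ⟧ ≡ 1ℤ - ⟦ f ⟧ + ⟦ x ⟧
    edge true  true  _ = refl
    edge true  false _ = refl
    edge false false _ = refl
    edge false true  h = contradiction (h refl) λ ()
    expand : ∀ w f x → w * (1ℤ - f + x) ≡ (w * 1ℤ - w * f) + w * x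
    expand = solve-∀

  OddRoot : V → Set
  OddRoot v = root (c v) ≡ v × o (c v) ≡ true

  -- The sum counts the chosen paths ending at `v`: none unless `v` is the root of its class, and
  -- otherwise one for each vertex of the class, whose size is then even.
  even-rooted : ∀ v → ¬ OddRoot v → + 2 ∣ ∑[ u < n G ] δ (root (c u)) v
  even-rooted v ¬odd with root (c v) ≟ v
  ... | no r≢v = divides 0ℤ (sum-0 (λ u → δ-≢ (λ r≡v → r≢v (begin
      root (c v)               ≡⟨ cong (root ∘ c) r≡v ⟨
      root (c (root (c u)))    ≡⟨ cong root (c-root (c u)) ⟩
      root (c u)               ≡⟨ r≡v ⟩
      v ∎))))
    where open ≡-Reasoning
  ... | yes r≡v with o (c v) B.≟ true
  ... | yes ov = contradiction (r≡v , ov) ¬odd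
  ... | no ¬ov = subst (+ 2 ∣_) (trans (card-tabulate _) (sum-cong same)) (¬odd⇒even (¬-not ¬ov))
    where
    same : ∀ u → ⟦ ⌊ c u ≟ c v ⌋ ⟧ ≡ δ (root (c u)) v
    same u with c u ≟ c v | root (c u) ≟ v
    ... | yes _ | yes _ = refl
    ... | no _  | no _  = refl
    ... | yes p | no ¬q = contradiction (trans (cong root p) r≡v) ¬q
    ... | no ¬p | yes q = contradiction (trans (sym (c-root (c u))) (cong c q)) ¬p

  -- Modulo 2, `inN` has the degree of `traffic`, and each path contributes only its ends. Exactly
  -- one path starts at `v` and `R` of them end there, so `inN` has degree `1 + R` and `inJ` has
  -- degree `2 + R`.
  even-deg-J : ∀ v → ¬ OddRoot v → + 2 ∣ deg G (⟦_⟧ ∘ inJ) v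
  even-deg-J v ¬odd = subst (+ 2 ∣_) (trans (combine T N R) (sym (deg-J v)))
    (∣m∣n⇒∣m+n (∣m∣n⇒∣m-n T≡1+R T≡N) (∣m∣n⇒∣m+n (divides 1ℤ refl) (even-rooted v ¬odd)))
    where
    T N R : ℤ
    T = deg G traffic v
    N = deg G (⟦_⟧ ∘ inN) v
    R = ∑[ u < n G ] δ (root (c u)) v
    T≡N : + 2 ∣ T - N
    T≡N = deg-congruent G traffic (⟦_⟧ ∘ inN) (λ e → odd-congruent (traffic e)) v
    ends : ∑[ u < n G ] (δ u v + δ (root (c u)) v) ≡ 1ℤ + R
    ends = trans (∑-distrib-+ _ _) (cong (_+ R) (trans (sum-cong (λ u → trans (δ-sym u v) (sym (*-identityʳ (δ v u)))))
             (sum-δ v (λ _ → 1ℤ))))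
    T≡1+R : + 2 ∣ T - (1ℤ + R)
    T≡1+R = subst (+ 2 ∣_) (trans (sum-diff _ _) (cong₂ _-_ (sym (deg-sum G (λ u → uses G (toRoot u)) v)) ends))
      (2∣-sum (λ u → deg-uses G (toRoot u) v))
    combine : ∀ T N R → (T - (1ℤ + R) - (T - N)) + (+ 2 + R) ≡ 1ℤ + N
    combine = solve-∀

  module OF = BalancedOrientation (balancedOrientation s t inF)
  module OJ = BalancedOrientation (balancedOrientation s t inJ)

  J-sign : ∀ e → OJ.sign e ≡ 1ℤ ⊎ OJ.sign e ≡ - 1ℤ ⊎ (inF e ≡ true × OJ.sign e ≡ 0ℤ)
  J-sign e with inJ e in Je
  ... | true  with OJ.sign-on e Je
  ...   | inj₁ p = inj₁ p
  ...   | inj₂ p = inj₂ (inj₁ p)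
  J-sign e | false = inj₂ (inj₂ (F-true (inF e) Je , OJ.sign-off e Je))
    where
    F-true : ∀ f {x} → not f ∨ x ≡ false → f ≡ true
    F-true true _ = refl

  opaque
    oriented : ∀ e → ∃[ D ] OF.sign e ≡ signed D ⟦ inF e ⟧ ×
      ∃[ a ] OF.sign e + (OF.sign e + OJ.sign e) ≡ signed D a × (1ℤ ≤ a × a ≤ + 3)
    oriented e = orientEdge (OF.sign e) (OJ.sign e) (OF.sign-on e) (OF.sign-off e) (J-sign e)

  D : E → Bool
  D e = proj₁ (oriented e)

  a : E → ℤ
  a e = proj₁ (proj₂ (proj₂ (oriented e)))

  exc-F : ∀ v → exc s t OF.sign v ≡ 0ℤ
  exc-F v = OF.even v (even-deg⇒even-exc G (⟦_⟧ ∘ inF) v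
    (divides 1ℤ (trans (sym (degIn-sum G F v)) (cong +_ (2-factor v)))))

  circulation : ∀ v → exc (tail G D) (head G D) (⟦_⟧ ∘ inF) v ≡ 0ℤ
  circulation v = trans (exc-oriented G D OF.sign _ (λ e → proj₁ (proj₂ (oriented e))) v) (exc-F v)

  -- The signs on `F` form a circulation, so their doubled part contributes nothing.
  exc-a : ∀ v → exc (tail G D) (head G D) a v ≡ exc s t OJ.sign v
  exc-a v = begin
    exc (tail G D) (head G D) a v
      ≡⟨ exc-oriented G D _ a (λ e → proj₁ (proj₂ (proj₂ (proj₂ (oriented e))))) v ⟩
    exc s t (λ e → OF.sign e + (OF.sign e + OJ.sign e)) v
      ≡⟨ trans (exc-+ s t _ _ v) (cong (_+_ (exc s t OF.sign v)) (exc-+ s t _ _ v)) ⟩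
    exc s t OF.sign v + (exc s t OF.sign v + exc s t OJ.sign v)
      ≡⟨ cong (λ i → i + (i + exc s t OJ.sign v)) (exc-F v) ⟩
    0ℤ + (0ℤ + exc s t OJ.sign v)
      ≡⟨ trans (+-identityˡ _) (+-identityˡ _) ⟩
    exc s t OJ.sign v ∎
    where open ≡-Reasoning

  marked≥0 : ∀ v j → 0ℤ ≤ δ (root j) v * ⟦ o j ⟧
  marked≥0 v j = ⟦⟧*-nonneg ⌊ root j ≟ v ⌋ (⟦⟧≥0 (o j))

  -- At the root of an odd class `almost` bounds the excess by 1. At any other vertex `inJ` has even
  -- degree and `even` makes the excess vanish.
  excess-bound : ∀ v → - marked root o v ≤ exc (tail G D) (head G D) a v
                     × exc (tail G D) (head G D) a v ≤ marked root o v
  excess-bound v = subst (λ x → - marked root o v ≤ x × x ≤ marked root o v) (sym (exc-a v)) bound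
    where
    bound : - marked root o v ≤ exc s t OJ.sign v × exc s t OJ.sign v ≤ marked root o v
    bound with (root (c v) ≟ v) ×-dec (o (c v) B.≟ true)
    ... | no ¬odd = ≤-trans (neg-mono-≤ (sum-nonneg (marked≥0 v))) (≤-reflexive (sym zero-exc))
                  , ≤-trans (≤-reflexive zero-exc) (sum-nonneg (marked≥0 v))
      where
      zero-exc : exc s t OJ.sign v ≡ 0ℤ
      zero-exc = OJ.even v (even-deg⇒even-exc G (⟦_⟧ ∘ inJ) v (even-deg-J v ¬odd))
    ... | yes (r≡v , ov) = ≤-trans (neg-mono-≤ 1≤marked) (proj₁ (OJ.almost v))
                         , ≤-trans (proj₂ (OJ.almost v)) 1≤marked
      where
      1≤marked : 1ℤ ≤ marked root o v
      1≤marked = ≤-trans (≤-reflexive (sym (cong₂ _*_ (trans (cong (λ x → δ x v) r≡v) (δ-refl v)) (cong ⟦_⟧ ov))))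
        (term≤sum (marked≥0 v) (c v))

  connected : ∀ (Y : V → Bool) → (∀ e → inF e ≡ true → Y (tail G D e) ≡ Y (head G D e)) →
    ∀ x y → c x ≡ c y → Y x ≡ Y y
  connected Y h x y cx≡cy = path-constant G Y (λ e e∈F → undirected (D e) (h e ([]=⇒lookup e∈F))) (path x y cx≡cy)
    where
    undirected : ∀ d {x y} → Y (if d then x else y) ≡ Y (if d then y else x) → Y x ≡ Y y
    undirected true  p = p
    undirected false p = sym p

  c-tail-head : ∀ e → inF e ≡ true → c (tail G D e) ≡ c (head G D e)
  c-tail-head e Fe = directed (D e) (c-edge e (lookup⇒[]= e F Fe))
    where
    directed : ∀ d {x y} → c x ≡ c y → c (if d then x else y) ≡ c (if d then y else x)
    directed true  p = p
    directed false p = sym p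

  open CutCondition (tail G D) (head G D) inF a (λ e → proj₂ (proj₂ (proj₂ (proj₂ (oriented e))))) circulation
    c c-tail-head connected root c-root o using (entering; leaving; circulation₁₄)

  -- Boundaries as separating edge cuts, and the conclusion

  boundary : (V → Bool) → Subset (m G)
  boundary X = tabulate (λ e → X (s e) xor X (t e))

  card-boundary : ∀ X → + card (boundary X) ≡ entering X + leaving X
  card-boundary X = trans (card-tabulate _) (trans (sum-cong (λ e → edge (D e) (s e) (t e))) (∑-distrib-+ _ _))
    where
    cases : ∀ x y → ⟦ x xor y ⟧ ≡ cross y x + cross x y
    cases true  true  = refl
    cases true  false = refl
    cases false true  = refl
    cases false false = refl
    edge : ∀ d x y → ⟦ X x xor X y ⟧ ≡ cross (X (if d then y else x)) (X (if d then x else y))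
                                     + cross (X (if d then x else y)) (X (if d then y else x))
    edge true  x y = cases (X x) (X y)
    edge false x y = trans (cases (X x) (X y)) (+-comm (cross (X y) (X x)) (cross (X x) (X y)))

  uncut : ∀ X e b → X (s e) ≡ b → X (t e) ≡ b → e ∉ boundary X
  uncut X e b p q e∈ = contradiction (trans (sym ([]=⇒lookup e∈)) (trans (lookup∘tabulate _ e)
      (trans (cong₂ _xor_ p q) (xor-same b)))) λ ()

  -- `X` is constant on each of the two classes, so the boundary contains no edge of their cycles.
  -- It is also constant along paths avoiding the boundary, so none of these joins the two roots.
  separates : ∀ X i j → o i ≡ true → o j ≡ true →
    (∀ v → c v ≡ i → X v ≡ true) → (∀ v → c v ≡ j → X v ≡ false) →
    SeparatesOddCycles G F c (boundary X)
  separates X i j oi oj inside outside = i , j , i≢j , isOdd i oi , isOdd j oj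
    , (λ e e∈F ce → uncut X e true (inside (s e) ce) (inside (t e) (trans (sym (c-edge e e∈F)) ce)))
    , (λ e e∈F ce → uncut X e false (outside (s e) ce) (outside (t e) (trans (sym (c-edge e e∈F)) ce)))
    , root i , root j , c-root i , c-root j
    , λ p → contradiction (trans (sym (inside _ (c-root i))) (trans (path-constant G X same p) (outside _ (c-root j)))) λ ()
    where
    i≢j : i ≢ j
    i≢j refl = contradiction (trans (sym (inside _ (c-root i))) (outside _ (c-root i))) λ ()
    isOdd : ∀ j → o j ≡ true → classSize G c j N.% 2 ≡ 1
    isOdd j oj with classSize G c j N.% 2 N.≟ 1
    ... | yes p = p
    isOdd j () | no _
    same : ∀ e → e ∈ ∁ (boundary X) → X (s e) ≡ X (t e)
    same e e∈∁ = xor-false (X (s e)) (X (t e))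
      (trans (sym (lookup∘tabulate _ e)) (∉⇒false (x∈∁p⇒x∉p e∈∁)))
      where
      xor-false : ∀ x y → x xor y ≡ false → x ≡ y
      xor-false true  true  _ = refl
      xor-false false false _ = refl

  nowhereZero5Flow : mBound G (oddClasses G c) F → NowhereZeroFlow G 5
  nowhereZero5Flow bound = finish (circulation₁₄ excess-bound separated)
    where
    ω≡ : + oddClasses G c ≡ ∑[ j < k ] ⟦ o j ⟧
    ω≡ = card-tabulate _
    separated : ∀ X i j → o i ≡ true → o j ≡ true →
      (∀ v → c v ≡ i → X v ≡ true) → (∀ v → c v ≡ j → X v ≡ false) →
      + 5 * ∑[ j < k ] ⟦ o j ⟧ ≤ + 2 * (entering X + leaving X) + + 2
    -- The bound on separating cuts, applied to the boundary of `X` and carried over to the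
    -- integers.
    separated X i j oi oj inside outside = subst₂ _≤_
      (trans (pos-* 5 (oddClasses G c)) (cong (_*_ (+ 5)) ω≡))
      (cong (_+ + 2) (trans (pos-* 2 (card (boundary X))) (cong (_*_ (+ 2)) (card-boundary X))))
      (+≤+ (bound k c labelling (boundary X) (separates X i j oi oj inside outside)))
    finish : (∃[ f ] (∀ e → 1ℤ ≤ f e × f e ≤ + 4) × (∀ v → exc (tail G D) (head G D) f v ≡ 0ℤ)) → NowhereZeroFlow G 5
    finish (f , bnd , circ) = circulation⇒flow G D f bnd circ

theorem2 : (G : Graph) (ω : ℕ) → Bridgeless G → Cubic G → IsOddness G ω →
    MStarBound G ω → NowhereZeroFlow G 5
-- Matching on `refl` turns the given oddness into the number of odd classes of `c`, the form in
-- which the cut bound is used.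
theorem2 G _ _ cubic _ (F , (2-factor , k , c , labelling , refl) , bound) =
  WithTwoFactor.nowhereZero5Flow G cubic F 2-factor c labelling bound
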